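{- Let $G$ be an oriented unicyclic graph on $n\ge 2$ vertices $1,\dots,n$ with edges $e_1,\dots,e_n$, with even cycle $C$, non-zero edge weights in $\mathbb{C}\setminus\mathbb{R}^-$, and complex signless incidence matrix $N$. Suppose $wt(C)\in\mathbb{C}\setminus\mathbb{R}^+$. Define the $n\times n$ matrix $F=(f_{ij})$ by, for $e_i=(u,v)$, $$f_{ij}=\begin{cases}(-1)^{d^*(j,u)}\dfrac{\frac{wt(\gamma_{u\to j})}{|wt(\gamma_{u\to j})|}}{\sqrt{\overline{w_{uv}}}\left(\frac{w_{uv}}{|w_{uv}|}-\frac{wt(\gamma_{u\to v})}{|wt(\gamma_{u\to v})|}\right)} & \text{if } e_i\in C,\\[3mm] 0 & \text{if } e_i\notin C,\ j\in G\setminus e_i[C],\\[1mm] (-1)^{d^*(j,u)}\dfrac{1}{\sqrt{w_{uv}}}\dfrac{|wt(\gamma_{j\to u})|}{wt(\gamma_{j\to u})} & \text{if } e_i\notin C,\ j\in G\setminus(e_i,u](C),\\[3mm] (-1)^{d^*(j,v)}\dfrac{1}{\sqrt{\overline{w_{uv}}}}\dfrac{|wt(\gamma_{j\to v})|}{wt(\gamma_{j\to v})} & \text{if } e_i\notin C,\ j\in G\setminus(e_i,v](C).\end{cases}$$ Then $F$ is the Moore--Penrose inverse of $N$.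
   Context: An oriented graph $G$ is obtained from a finite simple undirected graph $G_u$ (its underlying graph) by giving each edge exactly one direction. It is unicyclic if $G_u$ is connected and has exactly one cycle (so it has as many edges as vertices). Each directed edge $(u,v)$ (from $u$ to $v$) has a non-zero complex weight $w_{uv}$. $\mathbb{R}^+$ and $\mathbb{R}^-$ denote the positive and the negative real numbers, and $\sqrt{\cdot}$ is the principal square root. The complex signless incidence matrix $N=(n_{ij})$ (rows indexed by vertices, columns by edges) is given, for $e_j=(u,v)$, by $n_{ij}=\sqrt{w_{uv}}$ if $i=u$, $n_{ij}=\sqrt{\overline{w_{uv}}}$ if $i=v$, and $n_{ij}=0$ otherwise. Put $a_{ij}=w_{ij}$ if $(i,j)\in E(G)$, $a_{ij}=\overline{w_{ji}}$ if $(j,i)\in E(G)$, and $a_{ij}=0$ otherwise. The weight of a walk $\gamma=(i_1,\dots,i_k)$ in $G_u$ is $wt(\gamma)=\prod_{s=1}^{k-1}a_{i_si_{s+1}}$ (so a trivial one-vertex walk has weight $1$). $wt(C)$ is the weight of the closed walk going once around $C$ in either direction (the two directions give complex conjugate values, so the condition on $wt(C)$ does not depend on the choice). A cycle is even if its length is even. If $e_i=(u,v)\notin C$, removing $e_i$ from $G$ leaves two components: a unicyclic one, denoted $G\setminus e_i[C]$, and a tree; the tree is denoted $G\setminus(e_i,u](C)$ if it contains $u$ and $G\setminus(e_i,v](C)$ if it contains $v$. For vertices $s,r$, $d^*(s,r)$ and $\gamma_{s\to r}$ denote the distance and the unique walk without repeated vertices from $s$ to $r$ in the underlying graph of $G$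 with $e_i$ removed (if $e_i\in C$ this is a tree; if $e_i\notin C$ they are only used inside its tree component). -}

module Defs where

open import Algebra.Bundles using (CommutativeRing; RawRing)
import Algebra.Definitions as AlgebraDefinitions
import Algebra.Definitions.RawSemiring as RawSemiringDefinitions
import Algebra.Properties.Ring as RingProperties
import Algebra.Solver.Ring.NaturalCoefficients.Default as SemiringSolver
open import Data.Bool.Base using (if_then_else_)
open import Data.Fin.Base using (Fin; zero; suc; toℕ; fromℕ<)
open import Data.Fin.Properties using (any?; toℕ-fromℕ<; injective⇒≤)
  renaming (_≟_ to _≟ᶠ_)
open import Data.List.Base as List using (List; []; _∷_)
import Data.List.Membership.DecPropositional as DecMembership
open import Data.List.Membership.Propositional using (_∈_)
open import Data.List.Membership.Propositional.Properties using (∈-lookup)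
open import Data.List.Relation.Unary.All as All using (All)
open import Data.List.Relation.Unary.All.Properties using (¬Any⇒All¬)
open import Data.List.Relation.Unary.AllPairs using ([]; _∷_)
open import Data.List.Relation.Unary.Any using (here; there)
open import Data.List.Relation.Unary.Unique.Propositional using (Unique)
open import Data.Nat.Base as ℕ using (ℕ; zero; suc)
import Data.Nat.Divisibility as ℕ
open import Data.Product.Base using (Σ; ∃; _×_; _,_; proj₁; proj₂)
open import Data.Sum.Base using (_⊎_; inj₁; inj₂)
open import Data.Empty using (⊥)
open import Function.Base using (_∘_)
open import Function.Bundles using (_⇔_)
open import Level using (0ℓ)
open import Relation.Binary.Construct.Closure.ReflexiveTransitive
  using (Star; ε; _◅_; _◅◅_)
import Relation.Binary.Construct.StrictToNonStrict as StrictToNonStrict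
open import Relation.Binary.Core using (Rel)
open import Relation.Binary.Definitions using (Decidable; tri<; tri≈; tri>)
open import Relation.Binary.PropositionalEquality as ≡ using (_≡_; _≢_)
open import Relation.Binary.Structures using (IsStrictTotalOrder)
import Relation.Binary.Reasoning.Setoid as SetoidReasoning
open import Relation.Nullary.Decidable
  using (Dec; yes; no; does; map′; _×-dec_; _⊎-dec_; ¬?)
open import Relation.Nullary.Negation using (¬_; contradiction)
open import Relation.Unary using (Pred; Satisfiable)

-- The real numbers enter as an arbitrary Dedekind-complete ordered
-- field; classically this determines them up to unique isomorphism.
-- Equality is the ring's setoid equality.

record CompleteOrderedField : Set₁ where
  field
    commutativeRing : CommutativeRing 0ℓ 0ℓ

  open CommutativeRing commutativeRing public
  open AlgebraDefinitions _≈_ using (Invertible)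

  infix 4 _<_
  field
    _<_                : Rel Carrier 0ℓ
    isStrictTotalOrder : IsStrictTotalOrder _≈_ _<_
    1≉0                : ¬ 1# ≈ 0#
    invertible         : ∀ x → ¬ x ≈ 0# → Invertible 1# _*_ x
    +-monoˡ-<          : ∀ x {y z} → y < z → y + x < z + x
    *-pos              : ∀ {x y} → 0# < x → 0# < y → 0# < x * y

  open StrictToNonStrict _≈_ _<_ public using (_≤_)

  UpperBound : Pred Carrier 0ℓ → Pred Carrier 0ℓ
  UpperBound P b = ∀ {x} → P x → x ≤ b

  IsSupremum : Pred Carrier 0ℓ → Pred Carrier 0ℓ
  IsSupremum P s = UpperBound P s × (∀ {b} → UpperBound P b → s ≤ b)

  field
    complete : (P : Pred Carrier 0ℓ) → Satisfiable P → ∃ (UpperBound P) →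
               ∃ (IsSupremum P)

  open IsStrictTotalOrder isStrictTotalOrder public
    using (compare; _≟_; _<?_)

module Real (ℝ : CompleteOrderedField) where

  open CompleteOrderedField ℝ
  open IsStrictTotalOrder isStrictTotalOrder
    using (irrefl; <-respˡ-≈; <-respʳ-≈) renaming (trans to <-trans)
  open RingProperties ring using (-‿distribˡ-*; -‿distribʳ-*; -‿involutive)
  private module S = SemiringSolver commutativeSemiring
  open SetoidReasoning setoid

  -- 0# ⁻¹ is 0#, so that inversion is total.
  _⁻¹ : Carrier → Carrier
  x ⁻¹ with x ≟ 0#
  ... | yes _   = 0#
  ... | no  x≉0 = proj₁ (invertible x x≉0)

  *-inverseʳ : ∀ {x} → ¬ x ≈ 0# → x * x ⁻¹ ≈ 1#
  *-inverseʳ {x} x≉0 with x ≟ 0#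
  ... | yes x≈0 = contradiction x≈0 x≉0
  ... | no  x≉0 = proj₂ (proj₂ (invertible x x≉0))

  <-irrefl : ∀ {x} → ¬ x < x
  <-irrefl = irrefl refl

  ≤⇒≯ : ∀ {x y} → x ≤ y → ¬ y < x
  ≤⇒≯ (inj₁ x<y) y<x = <-irrefl (<-trans x<y y<x)
  ≤⇒≯ (inj₂ x≈y) y<x = irrefl (sym x≈y) y<x

  ≮⇒≥ : ∀ {x y} → ¬ x < y → y ≤ x
  ≮⇒≥ {x} {y} x≮y with compare x y
  ... | tri< x<y _ _ = contradiction x<y x≮y
  ... | tri≈ _ x≈y _ = inj₂ (sym x≈y)
  ... | tri> _ _ y<x = inj₁ y<x

  ≮≯⇒≈ : ∀ {x y} → ¬ x < y → ¬ y < x → x ≈ y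
  ≮≯⇒≈ {x} {y} x≮y y≮x with compare x y
  ... | tri< x<y _ _ = contradiction x<y x≮y
  ... | tri≈ _ x≈y _ = x≈y
  ... | tri> _ _ y<x = contradiction y<x y≮x

  x<0⇒0<-x : ∀ {x} → x < 0# → 0# < - x
  x<0⇒0<-x {x} x<0 =
    <-respˡ-≈ (-‿inverseʳ x) (<-respʳ-≈ (+-identityˡ (- x)) (+-monoˡ-< (- x) x<0))

  -x*-x≈x*x : ∀ x → (- x) * (- x) ≈ x * x
  -x*-x≈x*x x = begin
    (- x) * (- x)  ≈⟨ -‿distribˡ-* x (- x) ⟨
    - (x * (- x))  ≈⟨ -‿cong (-‿distribʳ-* x x) ⟨
    - (- (x * x))  ≈⟨ -‿involutive (x * x) ⟩
    x * x          ∎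

  0<1 : 0# < 1#
  0<1 with compare 0# 1#
  ... | tri< 0<1 _ _ = 0<1
  ... | tri≈ _ 0≈1 _ = contradiction (sym 0≈1) 1≉0
  ... | tri> _ _ 1<0 = <-respʳ-≈ (trans (-x*-x≈x*x 1#) (*-identityˡ 1#))
                         (*-pos (x<0⇒0<-x 1<0) (x<0⇒0<-x 1<0))

  -- x < y exactly when y exceeds x by a positive amount.
  diff : ∀ {x y} → x < y → ∃ λ d → 0# < d × y ≈ x + d
  diff {x} {y} x<y = y + - x , <-respˡ-≈ (-‿inverseʳ x) (+-monoˡ-< (- x) x<y) , (begin
    y              ≈⟨ +-identityʳ y ⟨
    y + 0#         ≈⟨ +-congˡ (-‿inverseˡ x) ⟨
    y + (- x + x)  ≈⟨ +-assoc y (- x) x ⟨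
    y + - x + x    ≈⟨ +-comm (y + - x) x ⟩
    x + (y + - x)  ∎)

  undiff : ∀ {x y d} → 0# < d → y ≈ x + d → x < y
  undiff {x} {y} {d} 0<d y≈ =
    <-respˡ-≈ (+-identityˡ x) (<-respʳ-≈ (trans (+-comm d x) (sym y≈)) (+-monoˡ-< x 0<d))

  +-pos : ∀ {x y} → 0# < x → 0# ≤ y → 0# < x + y
  +-pos {x} 0<x (inj₁ 0<y) = <-trans 0<x (undiff 0<y refl)
  +-pos {x} 0<x (inj₂ 0≈y) = <-respʳ-≈ (trans (sym (+-identityʳ x)) (+-congˡ 0≈y)) 0<x

  *-nonneg : ∀ {x y} → 0# ≤ x → 0# ≤ y → 0# ≤ x * y
  *-nonneg (inj₁ 0<x) (inj₁ 0<y) = inj₁ (*-pos 0<x 0<y)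
  *-nonneg {x} _ (inj₂ 0≈y) = inj₂ (trans (sym (zeroʳ x)) (*-congˡ 0≈y))
  *-nonneg {y = y} (inj₂ 0≈x) _ = inj₂ (trans (sym (zeroˡ y)) (*-congʳ 0≈x))

  +-nonneg : ∀ {x y} → 0# ≤ x → 0# ≤ y → 0# ≤ x + y
  +-nonneg (inj₁ 0<x) 0≤y = inj₁ (+-pos 0<x 0≤y)
  +-nonneg {x} {y} (inj₂ 0≈x) (inj₁ 0<y) = inj₁ (<-respʳ-≈ (+-comm y x) (+-pos 0<y (inj₂ 0≈x)))
  +-nonneg (inj₂ 0≈x) (inj₂ 0≈y) = inj₂ (trans (sym (+-identityˡ 0#)) (+-cong 0≈x 0≈y))

  square-nonneg : ∀ x → 0# ≤ x * x
  square-nonneg x with compare 0# x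
  ... | tri< 0<x _ _ = inj₁ (*-pos 0<x 0<x)
  ... | tri≈ _ 0≈x _ = *-nonneg (inj₂ 0≈x) (inj₂ 0≈x)
  ... | tri> _ _ x<0 = inj₁ (<-respʳ-≈ (-x*-x≈x*x x) (*-pos (x<0⇒0<-x x<0) (x<0⇒0<-x x<0)))

  square-mono-< : ∀ {x y} → 0# ≤ x → x < y → x * x < y * y
  square-mono-< {x} {y} 0≤x x<y with diff x<y
  ... | d , 0<d , y≈ = undiff
    (+-pos (*-pos 0<d 0<d) (*-nonneg (+-nonneg 0≤x 0≤x) (inj₁ 0<d)))
    (trans (*-cong y≈ y≈)
      (S.solve 2 (λ x d → (x S.:+ d) S.:* (x S.:+ d) S.:=
                          x S.:* x S.:+ (d S.:* d S.:+ (x S.:+ x) S.:* d)) refl x d))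

  square-cancel-< : ∀ {x y} → 0# ≤ y → x * x < y * y → x < y
  square-cancel-< {x} {y} 0≤y xx<yy with compare x y
  ... | tri< x<y _ _ = x<y
  ... | tri≈ _ x≈y _ = contradiction xx<yy (irrefl (*-cong x≈y x≈y))
  ... | tri> _ _ y<x = contradiction (<-trans xx<yy (square-mono-< 0≤y y<x)) <-irrefl

  *-cancelʳ-< : ∀ {x y z} → 0# < z → x * z < y * z → x < y
  *-cancelʳ-< {x} {y} {z} 0<z xz<yz with compare x y
  ... | tri< x<y _ _ = x<y
  ... | tri≈ _ x≈y _ = contradiction xz<yz (irrefl (*-congʳ x≈y))
  ... | tri> _ _ y<x with diff y<x
  ...   | d , 0<d , x≈ = contradiction
    (<-trans xz<yz (undiff (*-pos 0<d 0<z) (trans (*-congʳ x≈) (distribʳ z y d)))) <-irrefl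

  square-injective : ∀ {x y} → 0# ≤ x → 0# ≤ y → x * x ≈ y * y → x ≈ y
  square-injective {x} {y} 0≤x 0≤y xx≈yy with compare x y
  ... | tri< x<y _ _ = contradiction (square-mono-< 0≤x x<y) (irrefl xx≈yy)
  ... | tri≈ _ x≈y _ = x≈y
  ... | tri> _ _ y<x = contradiction (square-mono-< 0≤y y<x) (irrefl (sym xx≈yy))

  private
    module Identities where
      square-sum : ∀ p s a → (p * s + a) * (p * s + a) ≈
                   p * p * (s * s) + (p * s * a + p * s * a + a * a)
      square-sum = S.solve 3 (λ p s a →
        (p S.:* s S.:+ a) S.:* (p S.:* s S.:+ a) S.:=
        p S.:* p S.:* (s S.:* s) S.:+ (p S.:* s S.:* a S.:+ p S.:* s S.:* a S.:+ a S.:* a)) refl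

      scaled-square-sum : ∀ p s a → a * ((s + p) * (s + p)) ≈
                          a * (s * s) + (p * s * a + p * s * a + a * (p * p))
      scaled-square-sum = S.solve 3 (λ p s a →
        a S.:* ((s S.:+ p) S.:* (s S.:+ p)) S.:=
        a S.:* (s S.:* s) S.:+ (p S.:* s S.:* a S.:+ p S.:* s S.:* a S.:+ a S.:* (p S.:* p))) refl

      square-product : ∀ t q → t * t * (q * q) ≈ t * q * (t * q)
      square-product = S.solve 2 (λ t q →
        t S.:* t S.:* (q S.:* q) S.:= t S.:* q S.:* (t S.:* q)) refl

      regroup₁ : ∀ u z a c → u + (z + a * (a + c)) ≈ u + z + a * a + c * a
      regroup₁ = S.solve 4 (λ u z a c →
        u S.:+ (z S.:+ a S.:* (a S.:+ c)) S.:= u S.:+ z S.:+ a S.:* a S.:+ c S.:* a) refl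

      regroup₂ : ∀ S z a c d → a * S + z + a * a + c * (S + d) ≈
                 (a + c) * S + (z + a * a) + c * d
      regroup₂ = S.solve 5 (λ S z a c d →
        a S.:* S S.:+ z S.:+ a S.:* a S.:+ c S.:* (S S.:+ d) S.:=
        (a S.:+ c) S.:* S S.:+ (z S.:+ a S.:* a) S.:+ c S.:* d) refl

      regroup₃ : ∀ S z a c → (a + c) * S + (z + a * a) ≈ a * S + z + a * a + c * S
      regroup₃ = S.solve 4 (λ S z a c →
        (a S.:+ c) S.:* S S.:+ (z S.:+ a S.:* a) S.:=
        a S.:* S S.:+ z S.:+ a S.:* a S.:+ c S.:* S) refl

      regroup₄ : ∀ u z a c d → u + z + a * a + c * (a + d) ≈
                 u + (z + a * (a + c)) + c * d
      regroup₄ = S.solve 5 (λ u z a c d →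
        u S.:+ z S.:+ a S.:* a S.:+ c S.:* (a S.:+ d) S.:=
        u S.:+ (z S.:+ a S.:* (a S.:+ c)) S.:+ c S.:* d) refl

      regroup₅ : ∀ p s d → p * s + (s * s + d) ≈ s * (s + p) + d
      regroup₅ = S.solve 3 (λ p s d →
        p S.:* s S.:+ (s S.:* s S.:+ d) S.:= s S.:* (s S.:+ p) S.:+ d) refl

      regroup₆ : ∀ a d s p → a + d + s * p ≈ p * s + a + d
      regroup₆ = S.solve 4 (λ a d s p →
        a S.:+ d S.:+ s S.:* p S.:= p S.:* s S.:+ a S.:+ d) refl

      regroup₇ : ∀ o a → (o + a) * (o + a) ≈ a * o + (o * o + (a * o + a * a))
      regroup₇ = S.solve 2 (λ o a →
        (o S.:+ a) S.:* (o S.:+ a) S.:=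
        a S.:* o S.:+ (o S.:* o S.:+ (a S.:* o S.:+ a S.:* a))) refl

    open Identities

    -- With q = s + p and p² = a + c, the number t = (p s + a) / q satisfies
    -- t - s = (a - s²) / q  and  a - t² = c (a - s²) / q².
    module Approximant {a c p s t : Carrier} (pp≈a+c : p * p ≈ a + c) (0<c : 0# < c)
                       (0<s+p : 0# < s + p) (tq≈m : t * (s + p) ≈ p * s + a) where

      0<qq : 0# < (s + p) * (s + p)
      0<qq = *-pos 0<s+p 0<s+p

      z : Carrier
      z = p * s * a + p * s * a

      ttqq : t * t * ((s + p) * (s + p)) ≈ (a + c) * (s * s) + (z + a * a)
      ttqq = begin
        t * t * ((s + p) * (s + p))        ≈⟨ square-product t (s + p) ⟩
        t * (s + p) * (t * (s + p))        ≈⟨ *-cong tq≈m tq≈m ⟩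
        (p * s + a) * (p * s + a)          ≈⟨ square-sum p s a ⟩
        p * p * (s * s) + (z + a * a)      ≈⟨ +-congʳ (*-congʳ pp≈a+c) ⟩
        (a + c) * (s * s) + (z + a * a)    ∎

      aqq : a * ((s + p) * (s + p)) ≈ a * (s * s) + (z + a * (a + c))
      aqq = trans (scaled-square-sum p s a) (+-congˡ (+-congˡ (*-congˡ pp≈a+c)))

      tt<a : s * s < a → t * t < a
      tt<a ss<a with diff ss<a
      ... | d , 0<d , a≈ = *-cancelʳ-< 0<qq (undiff (*-pos 0<c 0<d) (begin
        a * ((s + p) * (s + p))                        ≈⟨ aqq ⟩
        a * (s * s) + (z + a * (a + c))                ≈⟨ regroup₁ (a * (s * s)) z a c ⟩
        a * (s * s) + z + a * a + c * a                ≈⟨ +-congˡ (*-congˡ a≈) ⟩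
        a * (s * s) + z + a * a + c * (s * s + d)      ≈⟨ regroup₂ (s * s) z a c d ⟩
        (a + c) * (s * s) + (z + a * a) + c * d        ≈⟨ +-congʳ ttqq ⟨
        t * t * ((s + p) * (s + p)) + c * d            ∎))

      s<t : s * s < a → s < t
      s<t ss<a with diff ss<a
      ... | d , 0<d , a≈ = *-cancelʳ-< 0<s+p (undiff 0<d (begin
        t * (s + p)          ≈⟨ tq≈m ⟩
        p * s + a            ≈⟨ +-congˡ a≈ ⟩
        p * s + (s * s + d)  ≈⟨ regroup₅ p s d ⟩
        s * (s + p) + d      ∎))

      a<tt : a < s * s → a < t * t
      a<tt a<ss with diff a<ss
      ... | d , 0<d , ss≈ = *-cancelʳ-< 0<qq (undiff (*-pos 0<c 0<d) (begin
        t * t * ((s + p) * (s + p))                    ≈⟨ ttqq ⟩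
        (a + c) * (s * s) + (z + a * a)                ≈⟨ regroup₃ (s * s) z a c ⟩
        a * (s * s) + z + a * a + c * (s * s)          ≈⟨ +-congˡ (*-congˡ ss≈) ⟩
        a * (s * s) + z + a * a + c * (a + d)          ≈⟨ regroup₄ (a * (s * s)) z a c d ⟩
        a * (s * s) + (z + a * (a + c)) + c * d        ≈⟨ +-congʳ aqq ⟨
        a * ((s + p) * (s + p)) + c * d                ∎))

      t<s : a < s * s → t < s
      t<s a<ss with diff a<ss
      ... | d , 0<d , ss≈ = *-cancelʳ-< 0<s+p (undiff 0<d (begin
        s * (s + p)        ≈⟨ distribˡ s s p ⟩
        s * s + s * p      ≈⟨ +-congʳ ss≈ ⟩
        a + d + s * p      ≈⟨ regroup₆ a d s p ⟩
        p * s + a + d      ≈⟨ +-congʳ tq≈m ⟨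
        t * (s + p) + d    ∎))

      0≤t : 0# ≤ p * s + a → 0# ≤ t
      0≤t 0≤m = ≮⇒≥ λ t<0 → ≤⇒≯ 0≤m (m<0 (diff t<0))
        where
        m<0 : (∃ λ d → 0# < d × 0# ≈ t + d) → p * s + a < 0#
        m<0 (d , 0<d , 0≈) = undiff (*-pos 0<d 0<s+p) (begin
          0#                         ≈⟨ zeroˡ (s + p) ⟨
          0# * (s + p)               ≈⟨ *-congʳ 0≈ ⟩
          (t + d) * (s + p)          ≈⟨ distribʳ (s + p) t d ⟩
          t * (s + p) + d * (s + p)  ≈⟨ +-congʳ tq≈m ⟩
          p * s + a + d * (s + p)    ∎)

    divide : ∀ m {q} → 0# < q → m * q ⁻¹ * q ≈ m
    divide m {q} 0<q = begin
      m * q ⁻¹ * q    ≈⟨ *-assoc m (q ⁻¹) q ⟩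
      m * (q ⁻¹ * q)  ≈⟨ *-congˡ (trans (*-comm _ _) (*-inverseʳ λ eq → irrefl (sym eq) 0<q)) ⟩
      m * 1#          ≈⟨ *-identityʳ m ⟩
      m               ∎

    module SquareRoot {a : Carrier} (0≤a : 0# ≤ a) where

      P : Pred Carrier 0ℓ
      P x = x * x ≤ a

      0∈P : P 0#
      0∈P = ≮⇒≥ λ a<00 → ≤⇒≯ 0≤a (<-respʳ-≈ (zeroˡ 0#) a<00)

      p c : Carrier
      p = 1# + a
      c = 1# + (a + a * a)

      0<p : 0# < p
      0<p = +-pos 0<1 0≤a

      0<c : 0# < c
      0<c = +-pos 0<1 (+-nonneg 0≤a (*-nonneg 0≤a 0≤a))

      pp≈a+c : p * p ≈ a + c
      pp≈a+c = trans (regroup₇ 1# a)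
        (+-cong (*-identityʳ a) (+-cong (*-identityʳ 1#) (+-congʳ (*-identityʳ a))))

      a<pp : a < p * p
      a<pp = undiff 0<c pp≈a+c

      bounded : UpperBound P p
      bounded xx≤a = ≮⇒≥ λ p<x →
        ≤⇒≯ xx≤a (<-trans a<pp (square-mono-< (inj₁ 0<p) p<x))

      sup : ∃ (IsSupremum P)
      sup = complete P (0# , 0∈P) (p , bounded)

      s : Carrier
      s = proj₁ sup

      0≤s : 0# ≤ s
      0≤s = proj₁ (proj₂ sup) 0∈P

      0<s+p : 0# < s + p
      0<s+p = <-respʳ-≈ (+-comm p s) (+-pos 0<p 0≤s)

      t : Carrier
      t = (p * s + a) * (s + p) ⁻¹

      private
        module A = Approximant {a} {c} {p} {s} {t} pp≈a+c 0<c 0<s+p (divide (p * s + a) 0<s+p)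

      ss≮a : ¬ s * s < a
      ss≮a ss<a = ≤⇒≯ (proj₁ (proj₂ sup) (inj₁ (A.tt<a ss<a))) (A.s<t ss<a)

      a≮ss : ¬ a < s * s
      a≮ss a<ss = ≤⇒≯ (proj₂ (proj₂ sup) bound) (A.t<s a<ss)
        where
        0≤t : 0# ≤ t
        0≤t = A.0≤t (+-nonneg (*-nonneg (inj₁ 0<p) 0≤s) 0≤a)

        bound : UpperBound P t
        bound xx≤a = ≮⇒≥ λ t<x →
          ≤⇒≯ xx≤a (<-trans (A.a<tt a<ss) (square-mono-< 0≤t t<x))

      ss≈a : s * s ≈ a
      ss≈a = ≮≯⇒≈ ss≮a a≮ss

  -- For a < 0# this is 0#; otherwise it is the supremum of the x with
  -- x * x ≤ a.
  √ : Carrier → Carrier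
  √ a with a <? 0#
  ... | yes _   = 0#
  ... | no  a≮0 = SquareRoot.s (≮⇒≥ a≮0)

  √-nonneg : ∀ a → 0# ≤ √ a
  √-nonneg a with a <? 0#
  ... | yes _   = inj₂ refl
  ... | no  a≮0 = SquareRoot.0≤s (≮⇒≥ a≮0)

  √-square : ∀ {a} → 0# ≤ a → √ a * √ a ≈ a
  √-square {a} 0≤a with a <? 0#
  ... | yes a<0 = contradiction a<0 (≤⇒≯ 0≤a)
  ... | no  a≮0 = SquareRoot.ss≈a (≮⇒≥ a≮0)

module Complex (ℝ : CompleteOrderedField) where

  open CompleteOrderedField ℝ
  open IsStrictTotalOrder isStrictTotalOrder
    using (irrefl; <-respˡ-≈; <-respʳ-≈) renaming (trans to <-trans)
  open RingProperties ring using (-‿distribˡ-*; -‿distribʳ-*; -‿involutive; -‿+-comm)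
  open Real ℝ
  private module S = SemiringSolver commutativeSemiring
  open SetoidReasoning setoid

  infix 6 _+i_
  record ℂ : Set where
    constructor _+i_
    field
      re im : Carrier

  open ℂ public

  infix  4 _≈ᶜ_
  infixl 6 _+ᶜ_ _-ᶜ_
  infixl 7 _*ᶜ_ _/ᶜ_

  _≈ᶜ_ : Rel ℂ 0ℓ
  z ≈ᶜ w = re z ≈ re w × im z ≈ im w

  0ᶜ 1ᶜ : ℂ
  0ᶜ = 0# +i 0#
  1ᶜ = 1# +i 0#

  fromℝ : Carrier → ℂ
  fromℝ x = x +i 0#

  -ᶜ_ conj : ℂ → ℂ
  -ᶜ z   = (- re z) +i (- im z)
  conj z = re z +i (- im z)

  _+ᶜ_ _*ᶜ_ _-ᶜ_ : ℂ → ℂ → ℂ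
  z +ᶜ w = (re z + re w) +i (im z + im w)
  z *ᶜ w = (re z * re w - im z * im w) +i (re z * im w + im z * re w)
  z -ᶜ w = z +ᶜ (-ᶜ w)

  normSq : ℂ → Carrier
  normSq z = re z * re z + im z * im z

  ∣_∣ : ℂ → Carrier
  ∣ z ∣ = √ (normSq z)

  _/ᶜ_ : ℂ → ℂ → ℂ
  z /ᶜ w = z *ᶜ (conj w *ᶜ fromℝ (normSq w ⁻¹))

  ½ : Carrier
  ½ = (1# + 1#) ⁻¹

  -- The principal square root: the one with positive real part or, when z
  -- is zero or a negative real, with nonnegative imaginary part.
  √ᶜ : ℂ → ℂ
  √ᶜ z = √ ((∣ z ∣ + re z) * ½) +i
         (if does (im z <? 0#) then - √ ((∣ z ∣ - re z) * ½)
                               else   √ ((∣ z ∣ - re z) * ½))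

  PositiveReal NegativeReal : Pred ℂ 0ℓ
  PositiveReal z = 0# < re z × im z ≈ 0#
  NegativeReal z = re z < 0# × im z ≈ 0#

  private
    half : ∀ x → x * ½ + x * ½ ≈ x
    half x = begin
      x * ½ + x * ½          ≈⟨ distribˡ x ½ ½ ⟨
      x * (½ + ½)            ≈⟨ *-congˡ (+-cong (*-identityˡ ½) (*-identityˡ ½)) ⟨
      x * (1# * ½ + 1# * ½)  ≈⟨ *-congˡ (distribʳ ½ 1# 1#) ⟨
      x * ((1# + 1#) * ½)    ≈⟨ *-congˡ (*-inverseʳ λ eq → irrefl (sym eq) 0<2) ⟩
      x * 1#                 ≈⟨ *-identityʳ x ⟩
      x                      ∎
      where
      0<2 : 0# < 1# + 1#
      0<2 = +-pos 0<1 (inj₁ 0<1)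

    0<½ : 0# < ½
    0<½ with compare 0# ½
    ... | tri< 0<½ _ _ = 0<½
    ... | tri≈ _ 0≈½ _ = contradiction
            (trans (sym (half 1#)) (trans (+-cong 1½≈0 1½≈0) (+-identityˡ 0#))) 1≉0
      where
      1½≈0 : 1# * ½ ≈ 0#
      1½≈0 = trans (*-identityˡ ½) (sym 0≈½)
    ... | tri> _ _ ½<0 = contradiction 0<1 (≤⇒≯ (inj₁ 1<0))
      where
      1<0 : 1# < 0#
      1<0 = <-respˡ-≈ (trans (+-cong (sym (*-identityˡ ½)) (sym (*-identityˡ ½))) (half 1#))
              (<-trans (<-respʳ-≈ (+-identityˡ ½) (+-monoˡ-< ½ ½<0)) ½<0)

    -- Here z = a + b i has modulus r.
    module Polar {r a b : Carrier} (0≤r : 0# ≤ r) (rr≈ : r * r ≈ a * a + b * b) where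

      aa≤rr : ¬ r * r < a * a
      aa≤rr rr<aa with diff rr<aa
      ... | d , 0<d , aa≈ = irrefl (sym bb+d≈0) (<-respʳ-≈ (+-comm d (b * b)) (+-pos 0<d (square-nonneg b)))
        where
        bb+d≈0 : b * b + d ≈ 0#
        bb+d≈0 = begin
          b * b + d                        ≈⟨ +-identityˡ (b * b + d) ⟨
          0# + (b * b + d)                 ≈⟨ +-congʳ (-‿inverseˡ (a * a)) ⟨
          - (a * a) + a * a + (b * b + d)  ≈⟨ +-assoc _ _ _ ⟩
          - (a * a) + (a * a + (b * b + d)) ≈⟨ +-congˡ (+-assoc _ _ _) ⟨
          - (a * a) + (a * a + b * b + d)  ≈⟨ +-congˡ (+-congʳ rr≈) ⟨
          - (a * a) + (r * r + d)          ≈⟨ +-congˡ aa≈ ⟨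
          - (a * a) + a * a                ≈⟨ -‿inverseˡ (a * a) ⟩
          0#                               ∎

      neg-swap : ∀ {x y} → x + y < 0# → x < - y
      neg-swap {x} {y} lt = <-respˡ-≈
        (trans (+-assoc x y (- y)) (trans (+-congˡ (-‿inverseʳ y)) (+-identityʳ x)))
        (<-respʳ-≈ (+-identityˡ (- y)) (+-monoˡ-< (- y) lt))

      0≤r+a : 0# ≤ r + a
      0≤r+a = ≮⇒≥ λ lt → aa≤rr (<-respʳ-≈ (-x*-x≈x*x a) (square-mono-< 0≤r (neg-swap lt)))

      0≤r-a : 0# ≤ r - a
      0≤r-a = ≮⇒≥ λ lt → aa≤rr (square-mono-< 0≤r (<-respʳ-≈ (-‿involutive a) (neg-swap lt)))

      module Root {p q : Carrier} (0≤p : 0# ≤ p) (0≤q : 0# ≤ q)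
                  (pp≈ : p * p ≈ (r + a) * ½) (qq≈ : q * q ≈ (r - a) * ½) where

        real : p * p - q * q ≈ a
        real = begin
          p * p - q * q                        ≈⟨ +-cong pp≈ (-‿cong qq≈) ⟩
          (r + a) * ½ - (r - a) * ½            ≈⟨ +-congˡ (-‿distribˡ-* (r - a) ½) ⟩
          (r + a) * ½ + (- (r - a)) * ½        ≈⟨ +-congˡ (*-congʳ (-‿+-comm r (- a))) ⟨
          (r + a) * ½ + (- r + - (- a)) * ½    ≈⟨ +-congˡ (*-congʳ (+-congˡ (-‿involutive a))) ⟩
          (r + a) * ½ + (- r + a) * ½          ≈⟨ S.solve 4 (λ r n a h →
                                                    (r S.:+ a) S.:* h S.:+ (n S.:+ a) S.:* h S.:=
                                                    (r S.:+ n) S.:* h S.:+ (a S.:* h S.:+ a S.:* h)) refl r (- r) a ½ ⟩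
          (r - r) * ½ + (a * ½ + a * ½)        ≈⟨ +-cong (trans (*-congʳ (-‿inverseʳ r)) (zeroˡ ½)) (half a) ⟩
          0# + a                               ≈⟨ +-identityˡ a ⟩
          a                                    ∎

        k : Carrier
        k = p * q + q * p

        0≤k : 0# ≤ k
        0≤k = +-nonneg (*-nonneg 0≤p 0≤q) (*-nonneg 0≤q 0≤p)

        kk≈bb : k * k ≈ b * b
        kk≈bb = begin
          k * k
            ≈⟨ S.solve 2 (λ p q → (p S.:* q S.:+ q S.:* p) S.:* (p S.:* q S.:+ q S.:* p) S.:=
                 (p S.:* p S.:+ p S.:* p) S.:* (q S.:* q S.:+ q S.:* q)) refl p q ⟩
          (p * p + p * p) * (q * q + q * q)
            ≈⟨ *-cong (trans (+-cong pp≈ pp≈) (half (r + a))) (trans (+-cong qq≈ qq≈) (half (r - a))) ⟩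
          (r + a) * (r - a)
            ≈⟨ S.solve 3 (λ r a n → (r S.:+ a) S.:* (r S.:+ n) S.:=
                 r S.:* r S.:+ r S.:* (a S.:+ n) S.:+ a S.:* n) refl r a (- a) ⟩
          r * r + r * (a - a) + a * - a
            ≈⟨ +-cong (+-cong rr≈ (trans (*-congˡ (-‿inverseʳ a)) (zeroʳ r))) (sym (-‿distribʳ-* a a)) ⟩
          a * a + b * b + 0# + - (a * a)
            ≈⟨ +-congʳ (+-identityʳ _) ⟩
          a * a + b * b + - (a * a)
            ≈⟨ S.solve 3 (λ A B N → A S.:+ B S.:+ N S.:= B S.:+ (A S.:+ N)) refl (a * a) (b * b) (- (a * a)) ⟩
          b * b + (a * a + - (a * a))
            ≈⟨ trans (+-congˡ (-‿inverseʳ _)) (+-identityʳ _) ⟩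
          b * b ∎

        imag⁺ : ¬ b < 0# → k ≈ b
        imag⁺ b≮0 = square-injective 0≤k (≮⇒≥ b≮0) kk≈bb

        imag⁻ : b < 0# → p * - q + - q * p ≈ b
        imag⁻ b<0 = begin
          p * - q + - q * p          ≈⟨ +-cong (-‿distribʳ-* p q) (-‿distribˡ-* q p) ⟨
          - (p * q) + - (q * p)      ≈⟨ -‿+-comm (p * q) (q * p) ⟩
          - k                        ≈⟨ -‿cong (square-injective 0≤k (inj₁ (x<0⇒0<-x b<0))
                                          (trans kk≈bb (sym (-x*-x≈x*x b)))) ⟩
          - (- b)                    ≈⟨ -‿involutive b ⟩
          b                          ∎

        p≉0 : b < 0# → ¬ p ≈ 0#
        p≉0 b<0 p≈0 = irrefl (sym (trans (sym kk≈bb) eq)) 0<bb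
          where
          k≈0 : k ≈ 0#
          k≈0 = trans (+-cong (trans (*-congʳ p≈0) (zeroˡ q)) (trans (*-congˡ p≈0) (zeroʳ q)))
                      (+-identityˡ 0#)
          eq : k * k ≈ 0#
          eq = trans (*-congʳ k≈0) (zeroˡ k)
          0<bb : 0# < b * b
          0<bb = <-respʳ-≈ (-x*-x≈x*x b) (*-pos (x<0⇒0<-x b<0) (x<0⇒0<-x b<0))

  private
    module PrincipalRoot (z : ℂ) where
      0≤normSq : 0# ≤ normSq z
      0≤normSq = +-nonneg (square-nonneg (re z)) (square-nonneg (im z))

      open Polar {∣ z ∣} {re z} {im z} (√-nonneg (normSq z)) (√-square 0≤normSq) public
      open Root (√-nonneg ((∣ z ∣ + re z) * ½)) (√-nonneg ((∣ z ∣ - re z) * ½))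
                (√-square (*-nonneg 0≤r+a (inj₁ 0<½)))
                (√-square (*-nonneg 0≤r-a (inj₁ 0<½))) public

  √ᶜ-square : ∀ z → √ᶜ z *ᶜ √ᶜ z ≈ᶜ z
  √ᶜ-square z with im z <? 0#
  ... | yes b<0 = trans (+-congˡ (-‿cong (-x*-x≈x*x _))) real , imag⁻ b<0
    where open PrincipalRoot z
  ... | no  b≮0 = real , imag⁺ b≮0
    where open PrincipalRoot z

  √ᶜ-principal : ∀ z → 0# < re (√ᶜ z) ⊎ (re (√ᶜ z) ≈ 0# × 0# ≤ im (√ᶜ z))
  √ᶜ-principal z with im z <? 0# | √-nonneg ((∣ z ∣ + re z) * ½)
  ... | _       | inj₁ 0<p = inj₁ 0<p
  ... | yes b<0 | inj₂ 0≈p = contradiction (sym 0≈p) (PrincipalRoot.p≉0 z b<0)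
  ... | no  _   | inj₂ 0≈p = inj₂ (sym 0≈p , √-nonneg _)

  ℂ-rawRing : RawRing 0ℓ 0ℓ
  ℂ-rawRing = record
    { Carrier = ℂ ; _≈_ = _≈ᶜ_ ; _+_ = _+ᶜ_ ; _*_ = _*ᶜ_ ; -_ = -ᶜ_ ; 0# = 0ᶜ ; 1# = 1ᶜ }

  open RawSemiringDefinitions (RawRing.rawSemiring ℂ-rawRing) public
    using (sum) renaming (_^_ to _^ᶜ_)

  Matrix : ℕ → ℕ → Set
  Matrix m n = Fin m → Fin n → ℂ

  infix  4 _≈ᴹ_
  infixl 7 _*ᴹ_

  _≈ᴹ_ : ∀ {m n} → Rel (Matrix m n) 0ℓ
  A ≈ᴹ B = ∀ i j → A i j ≈ᶜ B i j

  _*ᴹ_ : ∀ {l m n} → Matrix l m → Matrix m n → Matrix l n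
  (A *ᴹ B) i j = sum λ k → A i k *ᶜ B k j

  _ᴴ : ∀ {m n} → Matrix m n → Matrix n m
  (A ᴴ) i j = conj (A j i)

  record IsMoorePenroseInverse {m n} (A : Matrix m n) (X : Matrix n m) : Set where
    field
      AXA≈A        : A *ᴹ X *ᴹ A ≈ᴹ A
      XAX≈X        : X *ᴹ A *ᴹ X ≈ᴹ X
      AX-hermitian : (A *ᴹ X) ᴴ ≈ᴹ A *ᴹ X
      XA-hermitian : (X *ᴹ A) ᴴ ≈ᴹ X *ᴹ A

-- A walk is an element of Star R: the one-vertex walk is ε and x ◅ p puts
-- the step x in front of p.

module _ {n} {R : Rel (Fin n) 0ℓ} where

  length : ∀ {i j} → Star R i j → ℕ
  length ε       = 0
  length (_ ◅ p) = suc (length p)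

  vertices : ∀ {i j} → Star R i j → List (Fin n)
  vertices {i} ε       = i ∷ []
  vertices {i} (_ ◅ p) = i ∷ vertices p

Path : ∀ {n} → Rel (Fin n) 0ℓ → Rel (Fin n) 0ℓ
Path R i j = Σ (Star R i j) λ p → Unique (vertices p)

-- The least k with P k, and n if there is none.
least : ∀ {n} {P : Pred (Fin n) 0ℓ} → (∀ k → Dec (P k)) → ℕ
least {zero}  P? = 0
least {suc n} P? = if does (P? zero) then 0 else suc (least (P? ∘ suc))

module _ {n} {R : Rel (Fin n) 0ℓ} where

  length-vertices : ∀ {i j} (p : Star R i j) → List.length (vertices p) ≡ suc (length p)
  length-vertices ε       = ≡.refl
  length-vertices (_ ◅ p) = ≡.cong suc (length-vertices p)

  pathFrom : ∀ {i j k} (p : Star R i j) → Unique (vertices p) → k ∈ vertices p → Path R k j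
  pathFrom ε       u       (here ≡.refl) = ε , u
  pathFrom (x ◅ p) u       (here ≡.refl) = x ◅ p , u
  pathFrom (_ ◅ p) (_ ∷ u) (there k∈p)   = pathFrom p u k∈p

  toPath : ∀ {i j} → Star R i j → Path R i j
  toPath ε = ε , All.[] ∷ []
  toPath {i} (x ◅ w) with toPath w
  ... | p , u with DecMembership._∈?_ _≟ᶠ_ i (vertices p)
  ...   | yes i∈p = pathFrom p u i∈p
  ...   | no  i∉p = x ◅ p , ¬Any⇒All¬ (vertices p) i∉p ∷ u

  lookup-injective : ∀ {xs : List (Fin n)} → Unique xs →
                     ∀ {i j} → List.lookup xs i ≡ List.lookup xs j → i ≡ j
  lookup-injective (_ ∷ _)  {zero}  {zero}  _  = ≡.refl
  lookup-injective (x∉ ∷ _) {zero}  {suc j} eq = contradiction eq (All.lookup x∉ (∈-lookup j))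
  lookup-injective (x∉ ∷ _) {suc i} {zero}  eq = contradiction (≡.sym eq) (All.lookup x∉ (∈-lookup i))
  lookup-injective (_ ∷ u)  {suc i} {suc j} eq = ≡.cong suc (lookup-injective u eq)

  path-length< : ∀ {i j} (p : Star R i j) → Unique (vertices p) → length p ℕ.< n
  path-length< p u = ≡.subst (ℕ._≤ n) (length-vertices p) (injective⇒≤ (lookup-injective u))

  WalkOfLength : ℕ → Rel (Fin n) 0ℓ
  WalkOfLength k i j = Σ (Star R i j) λ p → length p ≡ k

  module _ (R? : Decidable R) where

    walkOfLength? : ∀ k → Decidable (WalkOfLength k)
    walkOfLength? zero i j =
      map′ (λ { ≡.refl → ε , ≡.refl }) (λ { (ε , _) → ≡.refl }) (i ≟ᶠ j)
    walkOfLength? (suc k) i j =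
      map′ (λ { (_ , x , p , ≡.refl) → x ◅ p , ≡.refl })
           (λ { (x ◅ p , ≡.refl) → _ , x , p , ≡.refl })
           (any? λ l → R? i l ×-dec walkOfLength? k l j)

    walk? : Decidable (Star R)
    walk? i j = map′ (λ (_ , p , _) → p) short (any? λ k → walkOfLength? (toℕ k) i j)
      where
      short : Star R i j → ∃ λ (k : Fin n) → WalkOfLength (toℕ k) i j
      short w with toPath w
      ... | p , u = fromℕ< (path-length< p u) , p , ≡.sym (toℕ-fromℕ< (path-length< p u))

    path? : Decidable (Path R)
    path? i j = map′ toPath proj₁ (walk? i j)

    -- The least length of a walk from i to j; in a graph on n vertices that
    -- length is below n if there is a walk at all.
    distance : Fin n → Fin n → ℕ
    distance i j = least {n} λ k → walkOfLength? (toℕ k) i j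

record OrientedGraph (n m : ℕ) : Set where
  field
    src tgt : Fin m → Fin n

  Joins : Fin m → Rel (Fin n) 0ℓ
  Joins e u v = (src e ≡ u × tgt e ≡ v) ⊎ (src e ≡ v × tgt e ≡ u)

  field
    loopless : ∀ e → src e ≢ tgt e
    simple   : ∀ {e f} → Joins e (src f) (tgt f) → e ≡ f

  Adj : Rel (Fin n) 0ℓ
  Adj u v = ∃ λ e → Joins e u v

  -- Adjacency in the underlying graph once e is removed.
  AdjWithout : Fin m → Rel (Fin n) 0ℓ
  AdjWithout e u v = ∃ λ f → f ≢ e × Joins f u v

  joins? : ∀ e → Decidable (Joins e)
  joins? e u v = (src e ≟ᶠ u ×-dec tgt e ≟ᶠ v) ⊎-dec (src e ≟ᶠ v ×-dec tgt e ≟ᶠ u)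

  adjWithout? : ∀ e → Decidable (AdjWithout e)
  adjWithout? e u v = any? λ f → ¬? (f ≟ᶠ e) ×-dec joins? f u v

  Connected : Set
  Connected = ∀ u v → Star Adj u v

  Traverses : ∀ {u v} → Fin m → Star Adj u v → Set
  Traverses e ε             = ⊥
  Traverses e ((f , _) ◅ p) = e ≡ f ⊎ Traverses e p

  traverses? : ∀ {u v} e (p : Star Adj u v) → Dec (Traverses e p)
  traverses? e ε             = no λ ()
  traverses? e ((f , _) ◅ p) = (e ≟ᶠ f) ⊎-dec traverses? e p

  -- A cycle is given by a path with at least three vertices together with an
  -- edge from its end back to its start; this fixes a starting vertex and a
  -- direction.
  record Cycle : Set where
    field
      {base end} : Fin n
      path       : Star Adj base end
      isPath     : Unique (vertices path)
      long       : 2 ℕ.≤ length path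
      closing    : Adj end base

    closedWalk : Star Adj base base
    closedWalk = path ◅◅ (closing ◅ ε)

  open Cycle public using (base; closedWalk)

  infix 4 _∈ᶜ_ _∈ᶜ?_
  _∈ᶜ_ : Fin m → Cycle → Set
  e ∈ᶜ C = Traverses e (closedWalk C)

  _∈ᶜ?_ : ∀ e C → Dec (e ∈ᶜ C)
  e ∈ᶜ? C = traverses? e (closedWalk C)

  -- Cycles are identified when they have the same edges.
  record Unicyclic : Set where
    field
      connected : Connected
      cycle     : Cycle
      unique    : ∀ C → ∀ e → e ∈ᶜ C ⇔ e ∈ᶜ cycle

  EvenCycle : Cycle → Set
  EvenCycle C = 2 ℕ.∣ length (closedWalk C)

  module _ (C : Cycle) (e : Fin m) where

    -- For e not on C: the vertices of the component containing C once e is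
    -- removed.
    InUnicyclicPart : Pred (Fin n) 0ℓ
    InUnicyclicPart j = Star (AdjWithout e) j (base C)

    -- For e not on C and x an end of e: the vertices of the tree component,
    -- provided that it contains x.
    InTreeAt : Fin n → Pred (Fin n) 0ℓ
    InTreeAt x j = ¬ InUnicyclicPart x × Star (AdjWithout e) j x

    inUnicyclicPart? : ∀ j → Dec (InUnicyclicPart j)
    inUnicyclicPart? j = walk? (adjWithout? e) j (base C)

    inTreeAt? : ∀ x j → Dec (InTreeAt x j)
    inTreeAt? x j = ¬? (inUnicyclicPart? x) ×-dec walk? (adjWithout? e) j x

module Weighted (ℝ : CompleteOrderedField) {n m} (G : OrientedGraph n m)
                (w : Fin m → Complex.ℂ ℝ) where

  open Complex ℝ
  open OrientedGraph G

  a : Fin n → Fin n → ℂ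
  a i j with any? (λ e → src e ≟ᶠ i ×-dec tgt e ≟ᶠ j)
           | any? (λ e → src e ≟ᶠ j ×-dec tgt e ≟ᶠ i)
  ... | yes (e , _) | _           = w e
  ... | no _        | yes (e , _) = conj (w e)
  ... | no _        | no _        = 0ᶜ

  wt : ∀ {R : Rel (Fin n) 0ℓ} {i j} → Star R i j → ℂ
  wt ε                   = 1ᶜ
  wt (_◅_ {i} {j} _ p) = a i j *ᶜ wt p

  incidence : Matrix n m
  incidence i e =
    if does (i ≟ᶠ src e) then √ᶜ (w e)
    else if does (i ≟ᶠ tgt e) then √ᶜ (conj (w e))
    else 0ᶜ

  module _ (e : Fin m) where

    d* : Fin n → Fin n → ℕ
    d* = distance (adjWithout? e)

    -- The weight of the path from s to r avoiding e; it is only used where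
    -- such a path exists.
    wtγ : Fin n → Fin n → ℂ
    wtγ s r with path? (adjWithout? e) s r
    ... | yes (γ , _) = wt γ
    ... | no _        = 0ᶜ

    sign : Fin n → Fin n → ℂ
    sign s r = (-ᶜ 1ᶜ) ^ᶜ d* s r

  unit : ℂ → ℂ
  unit z = z /ᶜ fromℝ ∣ z ∣

  F : Cycle → Matrix m n
  F C e j =
    if does (e ∈ᶜ? C) then
      sign e j u *ᶜ (unit (wtγ e u j) /ᶜ
        (√ᶜ (conj (w e)) *ᶜ (unit (w e) -ᶜ unit (wtγ e u v))))
    else if does (inUnicyclicPart? C e j) then
      0ᶜ
    else if does (inTreeAt? C e u j) then
      sign e j u *ᶜ (1ᶜ /ᶜ √ᶜ (w e)) *ᶜ (fromℝ ∣ wtγ e j u ∣ /ᶜ wtγ e j u)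
    else if does (inTreeAt? C e v j) then
      sign e j v *ᶜ (1ᶜ /ᶜ √ᶜ (conj (w e))) *ᶜ (fromℝ ∣ wtγ e j v ∣ /ᶜ wtγ e j v)
    else
      0ᶜ -- excluded: every vertex falls under one of the cases above
    where
    u v : Fin n
    u = src e
    v = tgt e

{-# OPTIONS --safe #-}
-- Column f of the incidence matrix N has only two nonzero entries: s = √w_f at the source x of f
-- and s̄ at the target y, with s = unit (w_f) s̄. So (F N)_{ef} = F_{ex} s + F_{ey} s̄, and for f ≠ e
-- this vanishes if walking along f multiplies the entry of F by - unit (a_xy). It does, because the
-- sign and the unit weight of a walk avoiding e depend only on its ends wherever F uses them: the
-- components of G - e in question contain no cycle, and backtracking along an edge contributes 1.
-- The diagonal entry is 1: for e on C because C is even and its unit weight is not 1, for e off C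
-- because exactly one end of e lies in the tree component. So F N = I, and a left inverse of a
-- square matrix over a field is its two-sided inverse.

module Submission where

open import Algebra.Bundles using (CommutativeMonoid; CommutativeRing)
import Algebra.Properties.CommutativeMonoid.Sum as CommutativeMonoidSum
import Algebra.Properties.Ring as RingProperties
import Algebra.Properties.Semiring.Sum as SemiringSum
import Algebra.Solver.Ring.NaturalCoefficients.Default as SemiringSolver
open import Data.Bool.Base using (true; false; if_then_else_)
open import Data.Empty using (⊥-elim)
open import Data.Fin.Base using (Fin; zero; suc; toℕ; fromℕ<; punchIn)
open import Data.Fin.Properties using (any?; toℕ-fromℕ<) renaming (_≟_ to _≟ᶠ_)
open import Data.List.Base as List using (List)
import Data.List.Membership.DecPropositional as DecMembership
open import Data.List.Membership.Propositional using (_∈_)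
open import Data.List.Relation.Unary.All as All using ([])
open import Data.List.Relation.Unary.All.Properties using (¬Any⇒All¬; All¬⇒¬Any)
open import Data.List.Relation.Unary.AllPairs using ([]; _∷_)
open import Data.List.Relation.Unary.Any using (here; there)
open import Data.List.Relation.Unary.Unique.Propositional using (Unique)
open import Data.Nat.Base as ℕ using (ℕ; zero; suc; s≤s; z≤n; _≤_)
open import Data.Nat.Divisibility using (divides)
open import Data.Product.Base using (Σ; ∃; ∃₂; _×_; _,_; proj₁; proj₂)
open import Data.Sum.Base using (_⊎_; inj₁; inj₂; [_,_]; [_,_]′; swap)
open import Data.Vec.Functional using (insertAt)
open import Data.Vec.Functional.Properties using (insertAt-lookup; insertAt-punchIn)
open import Function.Base using (_∘_; id)
open import Function.Bundles using (Equivalence)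
open import Level using (0ℓ)
open import Relation.Binary.Construct.Closure.ReflexiveTransitive as Star
  using (Star; ε; _◅_; _◅◅_)
open import Relation.Binary.Core using (Rel)
open import Relation.Binary.Definitions using (Decidable; Symmetric; tri<; tri≈; tri>)
open import Relation.Binary.PropositionalEquality as ≡ using (_≡_; _≢_)
import Relation.Binary.Reasoning.Setoid as SetoidReasoning
open import Relation.Binary.Structures using (IsStrictTotalOrder)
open import Relation.Nullary.Decidable
  using (Dec; yes; no; does; _×-dec_; ¬?; decidable-stable)
open import Relation.Nullary.Negation using (¬_; contradiction)
open import Relation.Unary using (Pred)
open import Defs

-- Sign and unit weight of a walk are two instances of one notion, the gain of a walk in a
-- commutative monoid in which only the elements attached to edges need inverses. The weight itself
-- would not do: going along f and back contributes |w_f|², so only after division by the modulus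
-- can the value depend on the ends alone. The walks behind `d*` and `wtγ` come out of searches, and
-- nothing is used about which walk a search finds. Instead, loops are erased from an arbitrary
-- walk: without cycles every loop to be erased is a single edge passed there and back, of gain 1.
-- The one property needed is that a component of G - e has no cycle; it holds for all of G - e if e
-- is on C, and for the tree component otherwise. The hypotheses on the numbers enter at one point
-- each: w outside ℝ⁻ makes the principal root commute with conjugation, whence s = unit(w) s̄, and
-- wt(C) outside ℝ⁺ makes the denominators in F nonzero.

record DiscreteField : Set₁ where
  field
    commutativeRing : CommutativeRing 0ℓ 0ℓ

  open CommutativeRing commutativeRing public hiding (zero)

  infix 4 _≟_
  field
    _≟_     : Decidable _≈_
    1≉0     : ¬ 1# ≈ 0#
    inverse : ∀ {x} → ¬ x ≈ 0# → ∃ λ y → x * y ≈ 1#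

if-yes : ∀ {p a} {P : Set p} {A : Set a} (P? : Dec P) → P → {x y : A} →
         (if does P? then x else y) ≡ x
if-yes (yes _) _ = ≡.refl
if-yes (no ¬p) p = contradiction p ¬p

if-no : ∀ {p a} {P : Set p} {A : Set a} (P? : Dec P) → ¬ P → {x y : A} →
        (if does P? then x else y) ≡ y
if-no (yes p) ¬p = contradiction p ¬p
if-no (no _)  _  = ≡.refl

-- Linear algebra over a field with decidable equality.

module FieldProperties (K : DiscreteField) where

  open DiscreteField K
  open SetoidReasoning setoid

  *-cancelˡ-nonzero : ∀ {x y z} → ¬ x ≈ 0# → x * y ≈ x * z → y ≈ z
  *-cancelˡ-nonzero {x} {y} {z} x≉0 xy≈xz with inverse x≉0
  ... | q , xq≈1 = begin
    y            ≈⟨ lemma y ⟨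
    q * (x * y)  ≈⟨ *-congˡ xy≈xz ⟩
    q * (x * z)  ≈⟨ lemma z ⟩
    z            ∎
    where
    lemma : ∀ t → q * (x * t) ≈ t
    lemma t = trans (sym (*-assoc q x t)) (trans (*-congʳ (trans (*-comm q x) xq≈1)) (*-identityˡ t))

  *-nonzero : ∀ {x y} → ¬ x ≈ 0# → ¬ y ≈ 0# → ¬ x * y ≈ 0#
  *-nonzero {x} x≉0 y≉0 xy≈0 = y≉0 (*-cancelˡ-nonzero x≉0 (trans xy≈0 (sym (zeroʳ x))))

module LinearAlgebra (K : DiscreteField) where

  open DiscreteField K
  open FieldProperties K
  open CommutativeMonoidSum +-commutativeMonoid
  open SemiringSum semiring using (*-distribˡ-sum; *-distribʳ-sum)
  open RingProperties ring using (-‿distribˡ-*; -‿distribʳ-*; -‿involutive)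
  open SetoidReasoning setoid
  private module S = SemiringSolver commutativeSemiring

  sum-cong : ∀ {n} {s t : Fin n → Carrier} → (∀ i → s i ≈ t i) → sum s ≈ sum t
  sum-cong = sum-cong-≋

  sum-zero : ∀ {n} {t : Fin n → Carrier} → (∀ i → t i ≈ 0#) → sum t ≈ 0#
  sum-zero {n} t≈0 = trans (sum-cong t≈0) (sum-replicate-zero n)

  identity : ∀ {n} → Fin n → Fin n → Carrier
  identity i j = if does (i ≟ᶠ j) then 1# else 0#

  sum-identityˡ : ∀ {n} i (t : Fin n → Carrier) → sum (λ k → identity i k * t k) ≈ t i
  sum-identityˡ {suc n} zero t =
    trans (+-cong (*-identityˡ _) (sum-zero {n} λ _ → zeroˡ (t (suc _)))) (+-identityʳ _)
  sum-identityˡ (suc i) t =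
    trans (+-cong (zeroˡ _) (sum-identityˡ i (λ k → t (suc k)))) (+-identityˡ _)

  identity-sym : ∀ {n} (i j : Fin n) → identity i j ≡ identity j i
  identity-sym zero    zero    = ≡.refl
  identity-sym zero    (suc _) = ≡.refl
  identity-sym (suc _) zero    = ≡.refl
  identity-sym (suc i) (suc j) = identity-sym i j

  -- Gaussian elimination of a variable with a nonzero coefficient in the first equation.
  nontrivialSolution : ∀ {n} (A : Fin n → Fin (suc n) → Carrier) →
    ∃ λ (c : Fin (suc n) → Carrier) → (∃ λ j → ¬ c j ≈ 0#) × (∀ i → sum (λ j → A i j * c j) ≈ 0#)
  nontrivialSolution {zero}  A = (λ _ → 1#) , (zero , 1≉0) , λ ()
  nontrivialSolution {suc n} A with any? (λ j → ¬? (A zero j ≟ 0#))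
  -- The first equation is vacuous. The remaining ones are solved without the first unknown, which
  -- is set to 0.
  ... | no allZero with nontrivialSolution (λ i j → A (suc i) (suc j))
  ...   | c , (j , cj≉0) , Ac≈0 = c′ , (suc j , cj≉0) , solves
    where
    c′ : Fin (suc (suc n)) → Carrier
    c′ zero    = 0#
    c′ (suc k) = c k

    solves : ∀ i → sum (λ k → A i k * c′ k) ≈ 0#
    solves zero    = sum-zero λ k →
      trans (*-congʳ {c′ k} (decidable-stable (A zero k ≟ 0#) λ ≉0 → allZero (k , ≉0))) (zeroˡ (c′ k))
    solves (suc i) = trans (+-cong (zeroʳ _) (Ac≈0 i)) (+-identityˡ 0#)
  nontrivialSolution {suc n} A | yes (j , p≉0) with inverse p≉0
  ... | q , pq≈1 with nontrivialSolution
          (λ i k → A (suc i) (punchIn j k) + - (A (suc i) j * q) * A zero (punchIn j k))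
  ...   | c , (k , ck≉0) , Bc≈0 =
    c′ , (punchIn j k , λ eq → ck≉0 (trans (sym (reflexive (c′-punchIn k))) eq)) , solves
    where
    rest : Fin (suc n) → Carrier
    rest i = sum (λ k → A i (punchIn j k) * c k)

    c′ : Fin (suc (suc n)) → Carrier
    -- `q` inverts the pivot, so this value of the pivot unknown solves the first equation.
    c′ = insertAt c j (- (q * rest zero))

    c′-punchIn : ∀ k → c′ (punchIn j k) ≡ c k
    c′-punchIn = insertAt-punchIn c j _

    split : ∀ i → sum (λ k → A i k * c′ k) ≈ A i j * - (q * rest zero) + rest i
    split i = trans (sum-remove {i = j} (λ k → A i k * c′ k))
      (+-cong (*-congˡ (reflexive (insertAt-lookup c j _)))
              (sum-cong {suc n} λ k → *-congˡ {A i (punchIn j k)} (reflexive (c′-punchIn k))))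

    solves : ∀ i → sum (λ k → A i k * c′ k) ≈ 0#
    solves zero = begin
      sum (λ k → A zero k * c′ k)                    ≈⟨ split zero ⟩
      A zero j * - (q * rest zero) + rest zero       ≈⟨ +-congʳ (-‿distribʳ-* _ _) ⟨
      - (A zero j * (q * rest zero)) + rest zero     ≈⟨ +-congʳ (-‿cong (*-assoc _ _ _)) ⟨
      - (A zero j * q * rest zero) + rest zero       ≈⟨ +-congʳ (-‿cong (*-congʳ pq≈1)) ⟩
      - (1# * rest zero) + rest zero                 ≈⟨ +-congʳ (-‿cong (*-identityˡ _)) ⟩
      - rest zero + rest zero                        ≈⟨ -‿inverseˡ _ ⟩
      0#                                             ∎
    solves (suc i) = begin
      sum (λ k → A (suc i) k * c′ k)                 ≈⟨ split (suc i) ⟩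
      A (suc i) j * - (q * rest zero) + rest (suc i) ≈⟨ +-congʳ (-‿distribʳ-* _ _) ⟨
      - (A (suc i) j * (q * rest zero)) + rest (suc i) ≈⟨ +-congʳ (-‿cong (*-assoc _ _ _)) ⟨
      - (A (suc i) j * q * rest zero) + rest (suc i) ≈⟨ +-congʳ (-‿distribˡ-* _ _) ⟩
      m * rest zero + rest (suc i)                   ≈⟨ +-comm _ _ ⟩
      rest (suc i) + m * rest zero                   ≈⟨ +-congˡ (*-distribˡ-sum m (λ k → A zero (punchIn j k) * c k)) ⟩
      rest (suc i) + sum (λ k → m * (A zero (punchIn j k) * c k))
        ≈⟨ ∑-distrib-+ (λ k → A (suc i) (punchIn j k) * c k) (λ k → m * (A zero (punchIn j k) * c k)) ⟨
      sum (λ k → A (suc i) (punchIn j k) * c k + m * (A zero (punchIn j k) * c k))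
        ≈⟨ sum-cong {suc n} (λ k → trans (distribʳ (c k) (A (suc i) (punchIn j k)) (m * A zero (punchIn j k))) (+-congˡ (*-assoc _ _ _))) ⟨
      sum (λ k → (A (suc i) (punchIn j k) + m * A zero (punchIn j k)) * c k)
        ≈⟨ Bc≈0 i ⟩
      0# ∎
      where
      m : Carrier
      m = - (A (suc i) j * q)

  module _ {n} {F N : Fin n → Fin n → Carrier}
           (FN≈I : ∀ i j → sum (λ k → F i k * N k j) ≈ identity i j) where

    private
      apply-FN : ∀ (v : Fin n → Carrier) i → sum (λ k → F i k * sum (λ j → N k j * v j)) ≈ v i
      apply-FN v i = begin
        sum (λ k → F i k * sum (λ j → N k j * v j))
          ≈⟨ sum-cong {n} (λ k → *-distribˡ-sum (F i k) (λ j → N k j * v j)) ⟩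
        sum (λ k → sum (λ j → F i k * (N k j * v j)))
          ≈⟨ ∑-comm (λ k j → F i k * (N k j * v j)) ⟩
        sum (λ j → sum (λ k → F i k * (N k j * v j)))
          ≈⟨ sum-cong {n} (λ j → sum-cong {n} λ k → *-assoc (F i k) (N k j) (v j)) ⟨
        sum (λ j → sum (λ k → F i k * N k j * v j))
          ≈⟨ sum-cong {n} (λ j → *-distribʳ-sum (v j) (λ k → F i k * N k j)) ⟨
        sum (λ j → sum (λ k → F i k * N k j) * v j)
          ≈⟨ sum-cong {n} (λ j → *-congʳ (FN≈I i j)) ⟩
        sum (λ j → identity i j * v j)
          ≈⟨ sum-identityˡ i v ⟩
        v i ∎

    -- A nontrivial relation between the columns of N and the column b must involve b,
    -- and F determines its other coefficients.
    surjective : ∀ (b : Fin n → Carrier) i → sum (λ j → N i j * sum (λ k → F j k * b k)) ≈ b i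
    surjective b with nontrivialSolution (λ i → λ { zero → b i ; (suc j) → N i j })
    ... | c , (j , cj≉0) , relation = λ i → *-cancelˡ-nonzero t≉0 (begin
      t * sum (λ j → N i j * Fb j)        ≈⟨ *-distribˡ-sum t (λ j → N i j * Fb j) ⟩
      sum (λ j → t * (N i j * Fb j))      ≈⟨ sum-cong {n} (λ j → exchange t (N i j) (Fb j)) ⟩
      sum (λ j → N i j * (t * Fb j))      ≈⟨ sum-cong {n} (λ j → *-congˡ (d≈ j)) ⟨
      sum (λ j → N i j * - d j)           ≈⟨ sum-cong {n} (λ j → trans (sym (-‿distribʳ-* _ _)) (neg _)) ⟩
      sum (λ j → - 1# * (N i j * d j))    ≈⟨ *-distribˡ-sum (- 1#) (λ j → N i j * d j) ⟨
      - 1# * sum (λ j → N i j * d j)      ≈⟨ neg _ ⟨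
      - sum (λ j → N i j * d j)           ≈⟨ -‿cong (Nd≈ i) ⟩
      - - (b i * t)                       ≈⟨ -‿involutive _ ⟩
      b i * t                             ≈⟨ *-comm _ _ ⟩
      t * b i                             ∎)
      where
      t : Carrier
      t = c zero

      d Fb : Fin n → Carrier
      d k = c (suc k)
      Fb j = sum (λ k → F j k * b k)

      exchange : ∀ x y z → x * (y * z) ≈ y * (x * z)
      exchange = S.solve 3 (λ x y z → x S.:* (y S.:* z) S.:= y S.:* (x S.:* z)) refl

      neg : ∀ x → - x ≈ - 1# * x
      neg x = trans (-‿cong (sym (*-identityˡ x))) (-‿distribˡ-* 1# x)

      negate : ∀ {x y} → x + y ≈ 0# → y ≈ - x
      negate {x} {y} x+y≈0 = begin
        y              ≈⟨ +-identityˡ y ⟨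
        0# + y         ≈⟨ +-congʳ (-‿inverseˡ x) ⟨
        - x + x + y    ≈⟨ +-assoc _ _ _ ⟩
        - x + (x + y)  ≈⟨ +-congˡ x+y≈0 ⟩
        - x + 0#       ≈⟨ +-identityʳ _ ⟩
        - x            ∎

      Nd≈ : ∀ i → sum (λ j → N i j * d j) ≈ - (b i * t)
      Nd≈ i = negate (relation i)

      d≈ : ∀ j → - d j ≈ t * Fb j
      d≈ j = begin
        - d j                                             ≈⟨ -‿cong (apply-FN d j) ⟨
        - sum (λ k → F j k * sum (λ l → N k l * d l))     ≈⟨ -‿cong (sum-cong {n} λ k → *-congˡ (Nd≈ k)) ⟩
        - sum (λ k → F j k * - (b k * t))                 ≈⟨ neg _ ⟩
        - 1# * sum (λ k → F j k * - (b k * t))            ≈⟨ *-distribˡ-sum (- 1#) (λ k → F j k * - (b k * t)) ⟩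
        sum (λ k → - 1# * (F j k * - (b k * t)))          ≈⟨ sum-cong {n} (λ k → trans (sym (neg _)) (-‿cong (sym (-‿distribʳ-* _ _)))) ⟩
        sum (λ k → - - (F j k * (b k * t)))               ≈⟨ sum-cong {n} (λ k → trans (-‿involutive _) (rotate (F j k) (b k) t)) ⟩
        sum (λ k → t * (F j k * b k))                     ≈⟨ *-distribˡ-sum t (λ k → F j k * b k) ⟨
        t * Fb j                                          ∎
        where
        rotate : ∀ x y z → x * (y * z) ≈ z * (x * y)
        rotate = S.solve 3 (λ x y z → x S.:* (y S.:* z) S.:= z S.:* (x S.:* y)) refl

      t≉0 : ¬ t ≈ 0#
      t≉0 t≈0 = cj≉0 (c≈0 j)
        where
        c≈0 : ∀ j → c j ≈ 0#
        c≈0 zero    = t≈0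
        c≈0 (suc k) = begin
          d k        ≈⟨ -‿involutive _ ⟨
          - - d k    ≈⟨ -‿cong (trans (d≈ k) (trans (*-congʳ t≈0) (zeroˡ _))) ⟩
          - 0#       ≈⟨ RingProperties.-0#≈0# ring ⟩
          0#         ∎

    -- Apply `surjective` to the j-th unit vector b: then F b is the j-th column of F.
    leftInverse⇒rightInverse : ∀ i j → sum (λ k → N i k * F k j) ≈ identity i j
    leftInverse⇒rightInverse i j = begin
      sum (λ k → N i k * F k j)
        ≈⟨ sum-cong {n} (λ k → *-congˡ (trans (sum-cong {n} λ l → *-comm (F k l) _)
                                          (sum-identityˡ j (F k)))) ⟨
      sum (λ k → N i k * sum (λ l → F k l * identity j l))
        ≈⟨ surjective (identity j) i ⟩
      identity j i
        ≡⟨ identity-sym j i ⟩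
      identity i j ∎

-- Square roots of real numbers.

module RealProperties (ℝ : CompleteOrderedField) where

  open CompleteOrderedField ℝ renaming (_≤_ to _≤ʳ_)
  open IsStrictTotalOrder isStrictTotalOrder
    using (<-respˡ-≈; <-respʳ-≈)
  open Real ℝ
  open SetoidReasoning setoid

  √-negative : ∀ {x} → x < 0# → √ x ≈ 0#
  √-negative {x} x<0 with x <? 0#
  ... | yes _   = refl
  ... | no  x≮0 = contradiction x<0 x≮0

  -- The root is a supremum chosen separately for each real, so compatibility with the setoid
  -- equality has to come from the uniqueness of a nonnegative root.
  √-cong : ∀ {x y} → x ≈ y → √ x ≈ √ y
  √-cong {x} {y} x≈y = lemma (x <? 0#)
    where
    lemma : Dec (x < 0#) → √ x ≈ √ y
    lemma (yes x<0) = trans (√-negative x<0) (sym (√-negative (<-respˡ-≈ x≈y x<0)))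
    lemma (no  x≮0) = square-injective (√-nonneg x) (√-nonneg y) (begin
      √ x * √ x  ≈⟨ √-square (≮⇒≥ x≮0) ⟩
      x          ≈⟨ x≈y ⟩
      y          ≈⟨ √-square (≮⇒≥ λ y<0 → x≮0 (<-respˡ-≈ (sym x≈y) y<0)) ⟨
      √ y * √ y  ∎)

  √-unique : ∀ {x y} → 0# ≤ʳ y → y * y ≈ x → √ x ≈ y
  √-unique {x} {y} 0≤y yy≈x = square-injective (√-nonneg x) 0≤y
    (trans (√-square (≤-resp (square-nonneg y))) (sym yy≈x))
    where
    ≤-resp : 0# ≤ʳ y * y → 0# ≤ʳ x
    ≤-resp (inj₁ 0<yy) = inj₁ (<-respʳ-≈ yy≈x 0<yy)
    ≤-resp (inj₂ 0≈yy) = inj₂ (trans 0≈yy yy≈x)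

  √0≈0 : ∀ {x} → x ≈ 0# → √ x ≈ 0#
  √0≈0 x≈0 = √-unique (inj₂ refl) (trans (zeroˡ 0#) (sym x≈0))

  square-zero : ∀ {x} → ¬ 0# < x * x → x ≈ 0#
  square-zero {x} 0≮xx with compare 0# x
  ... | tri< 0<x _ _ = contradiction (*-pos 0<x 0<x) 0≮xx
  ... | tri≈ _ 0≈x _ = sym 0≈x
  ... | tri> _ _ x<0 = contradiction
    (<-respʳ-≈ (-x*-x≈x*x x) (*-pos (x<0⇒0<-x x<0) (x<0⇒0<-x x<0))) 0≮xx

-- The field of complex numbers, unit parts and principal roots.

module ComplexProperties (ℝ : CompleteOrderedField) where

  open Complex ℝ
  open RealProperties ℝ

  private
    module Parts where
      open CompleteOrderedField ℝ public
      open RingProperties ring public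
        using (-‿distribˡ-*; -‿distribʳ-*; -‿involutive; -‿+-comm; -0#≈0#)
      open Real ℝ public

      module S = SemiringSolver commutativeSemiring

      m : Carrier
      m = - 1#

      -- Brings differences into a form that a semiring solver can treat, with `m` as one more
      -- variable.
      minus : ∀ {x x′ y y′} → x ≈ x′ → y ≈ y′ → x - y ≈ x′ + m * y′
      minus {y = y} {y′} x≈ y≈ = +-cong x≈
        (trans (-‿cong (trans (sym (*-identityˡ y)) (*-congˡ y≈))) (-‿distribˡ-* 1# y′))

    open Parts using (m; minus; module S)
    module R = Parts
    open R using (_≈_; 0#; _<_)

  -- ℂ is R[i] with i² = m; associativity and distributivity hold for every m,
  -- which makes them semiring identities.
  ℂ-commutativeRing : CommutativeRing 0ℓ 0ℓ
  ℂ-commutativeRing = record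
    { Carrier = ℂ ; _≈_ = _≈ᶜ_ ; _+_ = _+ᶜ_ ; _*_ = _*ᶜ_ ; -_ = -ᶜ_ ; 0# = 0ᶜ ; 1# = 1ᶜ
    ; isCommutativeRing = record
      { isRing = record
        { +-isAbelianGroup = record
          { isGroup = record
            { isMonoid = record
              { isSemigroup = record
                { isMagma = record
                  { isEquivalence = record
                    { refl = R.refl , R.refl
                    ; sym = λ (p , q) → R.sym p , R.sym q
                    ; trans = λ (p , q) (p′ , q′) → R.trans p p′ , R.trans q q′ }
                  ; ∙-cong = λ (p , q) (p′ , q′) → R.+-cong p p′ , R.+-cong q q′ }
                ; assoc = λ x y z → R.+-assoc _ _ _ , R.+-assoc _ _ _ }
              ; identity = (λ x → R.+-identityˡ _ , R.+-identityˡ _)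
                         , (λ x → R.+-identityʳ _ , R.+-identityʳ _) }
            ; inverse = (λ x → R.-‿inverseˡ _ , R.-‿inverseˡ _)
                      , (λ x → R.-‿inverseʳ _ , R.-‿inverseʳ _)
            ; ⁻¹-cong = λ (p , q) → R.-‿cong p , R.-‿cong q }
          ; comm = λ x y → R.+-comm _ _ , R.+-comm _ _ }
        ; *-cong = λ (p , q) (p′ , q′) →
            R.+-cong (R.*-cong p p′) (R.-‿cong (R.*-cong q q′)) ,
            R.+-cong (R.*-cong p q′) (R.*-cong q p′)
        ; *-assoc = assoc
        ; *-identity = identityˡ , λ z → ≈-trans (comm z 1ᶜ) (identityˡ z)
        ; distrib = distribˡ , λ z x y → ≈-trans (comm (x +ᶜ y) z) (≈-trans (distribˡ z x y)
            (R.+-cong (proj₁ (comm z x)) (proj₁ (comm z y)) ,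
             R.+-cong (proj₂ (comm z x)) (proj₂ (comm z y)))) }
      ; *-comm = comm } }
    where
    ≈-trans : ∀ {x y z} → x ≈ᶜ y → y ≈ᶜ z → x ≈ᶜ z
    ≈-trans (p , q) (p′ , q′) = R.trans p p′ , R.trans q q′

    comm : ∀ x y → x *ᶜ y ≈ᶜ y *ᶜ x
    comm (a +i b) (c +i d) = R.+-cong (R.*-comm a c) (R.-‿cong (R.*-comm b d)) ,
      S.solve 4 (λ a b c d → a S.:* d S.:+ b S.:* c S.:= c S.:* b S.:+ d S.:* a) R.refl a b c d

    identityˡ : ∀ z → 1ᶜ *ᶜ z ≈ᶜ z
    identityˡ (a +i b) =
      R.trans (minus (R.*-identityˡ a) (R.zeroˡ b)) (R.trans (R.+-congˡ (R.zeroʳ m)) (R.+-identityʳ a)) ,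
      R.trans (R.+-cong (R.*-identityˡ b) (R.zeroˡ a)) (R.+-identityʳ b)

    assoc : ∀ x y z → x *ᶜ y *ᶜ z ≈ᶜ x *ᶜ (y *ᶜ z)
    assoc (a +i b) (c +i d) (e +i f) =
      R.trans (minus (R.*-congʳ (minus R.refl R.refl)) R.refl) (R.trans
        (S.solve 7 (λ m a b c d e f →
          (a S.:* c S.:+ m S.:* (b S.:* d)) S.:* e S.:+ m S.:* ((a S.:* d S.:+ b S.:* c) S.:* f) S.:=
          a S.:* (c S.:* e S.:+ m S.:* (d S.:* f)) S.:+ m S.:* (b S.:* (c S.:* f S.:+ d S.:* e)))
          R.refl m a b c d e f)
        (R.sym (minus (R.*-congˡ (minus R.refl R.refl)) R.refl))) ,
      R.trans (R.+-congʳ (R.*-congʳ (minus R.refl R.refl))) (R.trans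
        (S.solve 7 (λ m a b c d e f →
          (a S.:* c S.:+ m S.:* (b S.:* d)) S.:* f S.:+ (a S.:* d S.:+ b S.:* c) S.:* e S.:=
          a S.:* (c S.:* f S.:+ d S.:* e) S.:+ b S.:* (c S.:* e S.:+ m S.:* (d S.:* f)))
          R.refl m a b c d e f)
        (R.sym (R.+-congˡ (R.*-congˡ (minus R.refl R.refl)))))

    distribˡ : ∀ x y z → x *ᶜ (y +ᶜ z) ≈ᶜ x *ᶜ y +ᶜ x *ᶜ z
    distribˡ (a +i b) (c +i d) (e +i f) =
      R.trans (minus R.refl R.refl) (R.trans
        (S.solve 7 (λ m a b c d e f →
          a S.:* (c S.:+ e) S.:+ m S.:* (b S.:* (d S.:+ f)) S.:=
          a S.:* c S.:+ m S.:* (b S.:* d) S.:+ (a S.:* e S.:+ m S.:* (b S.:* f)))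
          R.refl m a b c d e f)
        (R.sym (R.+-cong (minus R.refl R.refl) (minus R.refl R.refl)))) ,
      S.solve 6 (λ a b c d e f →
        a S.:* (d S.:+ f) S.:+ b S.:* (c S.:+ e) S.:=
        a S.:* d S.:+ b S.:* c S.:+ (a S.:* f S.:+ b S.:* e)) R.refl a b c d e f

  private
    module K = CommutativeRing ℂ-commutativeRing
    open SetoidReasoning K.setoid

  fromℝ-cong : ∀ {x y} → x ≈ y → fromℝ x ≈ᶜ fromℝ y
  fromℝ-cong x≈y = x≈y , R.refl

  fromℝ-* : ∀ x y → fromℝ (x R.* y) ≈ᶜ fromℝ x *ᶜ fromℝ y
  fromℝ-* x y =
    R.sym (R.trans (minus R.refl (R.zeroˡ 0#)) (R.trans (R.+-congˡ (R.zeroʳ m)) (R.+-identityʳ _))) ,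
    R.sym (R.trans (R.+-cong (R.zeroʳ x) (R.zeroˡ y)) (R.+-identityˡ 0#))

  conj-cong : ∀ {z w} → z ≈ᶜ w → conj z ≈ᶜ conj w
  conj-cong (p , q) = p , R.-‿cong q

  conj-* : ∀ z w → conj (z *ᶜ w) ≈ᶜ conj z *ᶜ conj w
  conj-* (a +i b) (c +i d) =
    R.+-congˡ (R.-‿cong (R.trans (R.sym (R.-‿involutive _)) (R.trans
      (R.-‿cong (R.-‿distribʳ-* b d)) (R.-‿distribˡ-* b (R.- d))))) ,
    R.trans (R.sym (R.-‿+-comm _ _)) (R.+-cong (R.-‿distribʳ-* a d) (R.-‿distribˡ-* b c))

  *-conj : ∀ z → z *ᶜ conj z ≈ᶜ fromℝ (normSq z)
  *-conj (a +i b) =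
    R.+-congˡ (R.trans (R.-‿cong (R.sym (R.-‿distribʳ-* b b))) (R.-‿involutive _)) ,
    R.trans (R.+-cong (R.sym (R.-‿distribʳ-* a b)) (R.*-comm b a)) (R.-‿inverseˡ _)

  normSq-cong : ∀ {z w} → z ≈ᶜ w → normSq z ≈ normSq w
  normSq-cong (p , q) = R.+-cong (R.*-cong p p) (R.*-cong q q)

  private
    module T = SemiringSolver K.commutativeSemiring

    regroup : ∀ p q r s → p *ᶜ q *ᶜ (r *ᶜ s) ≈ᶜ p *ᶜ r *ᶜ (q *ᶜ s)
    regroup = T.solve 4 (λ p q r s → p T.:* q T.:* (r T.:* s) T.:= p T.:* r T.:* (q T.:* s)) K.refl

  normSq-* : ∀ z w → normSq (z *ᶜ w) ≈ normSq z R.* normSq w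
  normSq-* z w = proj₁ (begin
    fromℝ (normSq (z *ᶜ w))               ≈⟨ *-conj (z *ᶜ w) ⟨
    z *ᶜ w *ᶜ conj (z *ᶜ w)               ≈⟨ K.*-congˡ {z *ᶜ w} (conj-* z w) ⟩
    z *ᶜ w *ᶜ (conj z *ᶜ conj w)          ≈⟨ regroup z w (conj z) (conj w) ⟩
    z *ᶜ conj z *ᶜ (w *ᶜ conj w)          ≈⟨ K.*-cong (*-conj z) (*-conj w) ⟩
    fromℝ (normSq z) *ᶜ fromℝ (normSq w)  ≈⟨ fromℝ-* (normSq z) (normSq w) ⟨
    fromℝ (normSq z R.* normSq w)         ∎)

  normSq-nonneg : ∀ z → 0# R.≤ normSq z
  normSq-nonneg z = R.+-nonneg (R.square-nonneg (re z)) (R.square-nonneg (im z))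

  normSq-zero : ∀ {z} → normSq z ≈ 0# → z ≈ᶜ 0ᶜ
  normSq-zero {z} ≈0 =
    square-zero (λ 0<aa → <-irrefl′ (R.+-pos 0<aa (R.square-nonneg (im z))) ≈0) ,
    square-zero (λ 0<bb → <-irrefl′ (R.+-pos 0<bb (R.square-nonneg (re z)))
      (R.trans (R.+-comm _ _) ≈0))
    where
    <-irrefl′ : ∀ {x} → 0# < x → ¬ x ≈ 0#
    <-irrefl′ 0<x x≈0 = IsStrictTotalOrder.irrefl R.isStrictTotalOrder (R.sym x≈0) 0<x

  -- `z /ᶜ w` is `z *ᶜ inv w` by definition, so quotients can be rearranged as products.
  inv : ℂ → ℂ
  inv z = conj z *ᶜ fromℝ (normSq z R.⁻¹)

  *-inv : ∀ {z} → ¬ z ≈ᶜ 0ᶜ → z *ᶜ inv z ≈ᶜ 1ᶜ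
  *-inv {z} z≉0 = begin
    z *ᶜ (conj z *ᶜ fromℝ (normSq z R.⁻¹))      ≈⟨ K.*-assoc z (conj z) _ ⟨
    z *ᶜ conj z *ᶜ fromℝ (normSq z R.⁻¹)        ≈⟨ K.*-congʳ (*-conj z) ⟩
    fromℝ (normSq z) *ᶜ fromℝ (normSq z R.⁻¹)   ≈⟨ fromℝ-* (normSq z) (normSq z R.⁻¹) ⟨
    fromℝ (normSq z R.* normSq z R.⁻¹)          ≈⟨ fromℝ-cong (R.*-inverseʳ λ ≈0 → z≉0 (normSq-zero ≈0)) ⟩
    1ᶜ                                          ∎

  ℂ-field : DiscreteField
  ℂ-field = record
    { commutativeRing = ℂ-commutativeRing
    ; _≟_             = λ z w → (re z R.≟ re w) ×-dec (im z R.≟ im w)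
    ; 1≉0             = λ (1≈0 , _) → R.1≉0 1≈0
    ; inverse         = λ {z} z≉0 → inv z , *-inv z≉0
    }

  open FieldProperties ℂ-field

  ∣∣-* : ∀ z w → ∣ z *ᶜ w ∣ ≈ ∣ z ∣ R.* ∣ w ∣
  ∣∣-* z w = √-unique (R.*-nonneg (R.√-nonneg _) (R.√-nonneg _))
    (R.trans (S.solve 2 (λ x y → x S.:* y S.:* (x S.:* y) S.:= x S.:* x S.:* (y S.:* y)) R.refl ∣ z ∣ ∣ w ∣)
      (R.trans (R.*-cong (R.√-square (normSq-nonneg z)) (R.√-square (normSq-nonneg w)))
               (R.sym (normSq-* z w))))

  ∣conj∣ : ∀ z → ∣ conj z ∣ ≈ ∣ z ∣
  ∣conj∣ z = √-cong (R.+-congˡ (R.-x*-x≈x*x (im z)))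

  modulus : ℂ → ℂ
  modulus z = fromℝ ∣ z ∣

  modulus-* : ∀ z w → modulus (z *ᶜ w) ≈ᶜ modulus z *ᶜ modulus w
  modulus-* z w = K.trans (fromℝ-cong (∣∣-* z w)) (fromℝ-* ∣ z ∣ ∣ w ∣)

  modulus-square : ∀ z → modulus z *ᶜ modulus z ≈ᶜ z *ᶜ conj z
  modulus-square z = begin
    modulus z *ᶜ modulus z   ≈⟨ fromℝ-* ∣ z ∣ ∣ z ∣ ⟨
    fromℝ (∣ z ∣ R.* ∣ z ∣)  ≈⟨ fromℝ-cong (R.√-square (normSq-nonneg z)) ⟩
    fromℝ (normSq z)         ≈⟨ *-conj z ⟨
    z *ᶜ conj z              ∎

  modulus-nonzero : ∀ {z} → ¬ z ≈ᶜ 0ᶜ → ¬ modulus z ≈ᶜ 0ᶜ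
  modulus-nonzero {z} z≉0 (∣z∣≈0 , _) = z≉0 (normSq-zero
    (R.trans (R.sym (R.√-square (normSq-nonneg z))) (R.trans (R.*-congʳ ∣z∣≈0) (R.zeroˡ _))))

  conj-nonzero : ∀ {z} → ¬ z ≈ᶜ 0ᶜ → ¬ conj z ≈ᶜ 0ᶜ
  conj-nonzero z≉0 (p , q) = z≉0 (p , R.trans (R.sym (R.-‿involutive _)) (R.trans (R.-‿cong q) R.-0#≈0#))

  -- Definitionally the `unit` occurring in `F`, but independent of a graph.
  unit : ℂ → ℂ
  unit z = z /ᶜ modulus z

  unit-modulus : ∀ {z} → ¬ z ≈ᶜ 0ᶜ → unit z *ᶜ modulus z ≈ᶜ z
  unit-modulus {z} z≉0 = begin
    z *ᶜ inv r *ᶜ r    ≈⟨ K.*-assoc z (inv r) r ⟩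
    z *ᶜ (inv r *ᶜ r)  ≈⟨ K.*-congˡ {z} (K.trans (K.*-comm (inv r) r) (*-inv (modulus-nonzero z≉0))) ⟩
    z *ᶜ 1ᶜ            ≈⟨ K.*-identityʳ z ⟩
    z                  ∎
    where
    r : ℂ
    r = modulus z

  unit-unique : ∀ {z u} → ¬ z ≈ᶜ 0ᶜ → u *ᶜ modulus z ≈ᶜ z → unit z ≈ᶜ u
  unit-unique {z} {u} z≉0 ur≈z = *-cancelˡ-nonzero (modulus-nonzero z≉0) (begin
    modulus z *ᶜ unit z  ≈⟨ K.*-comm (modulus z) (unit z) ⟩
    unit z *ᶜ modulus z  ≈⟨ unit-modulus z≉0 ⟩
    z                    ≈⟨ ur≈z ⟨
    u *ᶜ modulus z       ≈⟨ K.*-comm u (modulus z) ⟩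
    modulus z *ᶜ u       ∎)

  unit-* : ∀ {z w} → ¬ z ≈ᶜ 0ᶜ → ¬ w ≈ᶜ 0ᶜ → unit (z *ᶜ w) ≈ᶜ unit z *ᶜ unit w
  unit-* {z} {w} z≉0 w≉0 = unit-unique (*-nonzero z≉0 w≉0) (begin
    unit z *ᶜ unit w *ᶜ modulus (z *ᶜ w)          ≈⟨ K.*-congˡ {unit z *ᶜ unit w} (modulus-* z w) ⟩
    unit z *ᶜ unit w *ᶜ (modulus z *ᶜ modulus w)  ≈⟨ regroup (unit z) (unit w) (modulus z) (modulus w) ⟩
    unit z *ᶜ modulus z *ᶜ (unit w *ᶜ modulus w)  ≈⟨ K.*-cong (unit-modulus z≉0) (unit-modulus w≉0) ⟩
    z *ᶜ w                                        ∎)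

  unit-1 : unit 1ᶜ ≈ᶜ 1ᶜ
  unit-1 = unit-unique (λ (1≈0 , _) → R.1≉0 1≈0) (K.trans (K.*-identityˡ (modulus 1ᶜ))
    (fromℝ-cong (√-unique (inj₁ R.0<1)
      (R.sym (R.trans (R.+-congˡ (R.zeroˡ 0#)) (R.+-identityʳ _))))))

  -- Since |z̄| = |z|, multiplication by |z|² turns the left side into z z̄, which is |z|². This is
  -- why an edge passed there and back has trivial unit weight.
  unit-conj : ∀ {z} → ¬ z ≈ᶜ 0ᶜ → unit z *ᶜ unit (conj z) ≈ᶜ 1ᶜ
  unit-conj {z} z≉0 = *-cancelˡ-nonzero (*-nonzero r≉0 r≉0) (begin
    r *ᶜ r *ᶜ (unit z *ᶜ unit (conj z))            ≈⟨ regroup r r (unit z) (unit (conj z)) ⟩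
    r *ᶜ unit z *ᶜ (r *ᶜ unit (conj z))            ≈⟨ K.*-cong (K.*-comm r (unit z)) (K.*-comm r (unit (conj z))) ⟩
    unit z *ᶜ r *ᶜ (unit (conj z) *ᶜ r)            ≈⟨ K.*-congˡ {unit z *ᶜ r} (K.*-congˡ {unit (conj z)}
                                                       (fromℝ-cong (∣conj∣ z))) ⟨
    unit z *ᶜ r *ᶜ (unit (conj z) *ᶜ modulus (conj z))
      ≈⟨ K.*-cong (unit-modulus z≉0) (unit-modulus (conj-nonzero z≉0)) ⟩
    z *ᶜ conj z                                    ≈⟨ modulus-square z ⟨
    r *ᶜ r                                         ≈⟨ K.*-identityʳ (r *ᶜ r) ⟨
    r *ᶜ r *ᶜ 1ᶜ                                   ∎)
    where
    r : ℂ
    r = modulus z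
    r≉0 : ¬ r ≈ᶜ 0ᶜ
    r≉0 = modulus-nonzero z≉0

  modulus/-unit : ∀ {z} → ¬ z ≈ᶜ 0ᶜ → modulus z /ᶜ z *ᶜ unit z ≈ᶜ 1ᶜ
  modulus/-unit {z} z≉0 = begin
    modulus z *ᶜ inv z *ᶜ unit z    ≈⟨ rotate (modulus z) (inv z) (unit z) ⟩
    unit z *ᶜ modulus z *ᶜ inv z    ≈⟨ K.*-congʳ {inv z} (unit-modulus z≉0) ⟩
    z *ᶜ inv z                      ≈⟨ *-inv z≉0 ⟩
    1ᶜ                              ∎
    where
    rotate : ∀ x y z → x *ᶜ y *ᶜ z ≈ᶜ z *ᶜ x *ᶜ y
    rotate = T.solve 3 (λ x y z → x T.:* y T.:* z T.:= z T.:* x T.:* y) K.refl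

  unit≈1⇒positive : ∀ {z} → ¬ z ≈ᶜ 0ᶜ → unit z ≈ᶜ 1ᶜ → PositiveReal z
  unit≈1⇒positive {z} z≉0 uz≈1 = positive (R.√-nonneg (normSq z)) , proj₂ z≈r
    where
    z≈r : z ≈ᶜ modulus z
    z≈r = begin
      z                    ≈⟨ unit-modulus z≉0 ⟨
      unit z *ᶜ modulus z  ≈⟨ K.*-congʳ {modulus z} uz≈1 ⟩
      1ᶜ *ᶜ modulus z      ≈⟨ K.*-identityˡ (modulus z) ⟩
      modulus z            ∎

    positive : 0# R.≤ ∣ z ∣ → 0# < re z
    positive (inj₁ 0<r) = IsStrictTotalOrder.<-respʳ-≈ R.isStrictTotalOrder (R.sym (proj₁ z≈r)) 0<r
    positive (inj₂ 0≈r) = contradiction (R.sym 0≈r , R.refl) (modulus-nonzero z≉0)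

  √ᶜ-nonzero : ∀ {z} → ¬ z ≈ᶜ 0ᶜ → ¬ √ᶜ z ≈ᶜ 0ᶜ
  √ᶜ-nonzero {z} z≉0 √z≈0 = z≉0 (K.trans (K.sym (√ᶜ-square z))
    (K.trans (K.*-congʳ {√ᶜ z} √z≈0) (K.zeroˡ (√ᶜ z))))

  -- For nonreal z, conjugation flips the sign chosen for the imaginary part of the root. Real z are
  -- fixed by conjugation, so their root has to be real; this fails exactly on the negative reals.
  √ᶜ-conj : ∀ z → ¬ NegativeReal z → √ᶜ (conj z) ≈ᶜ conj (√ᶜ z)
  √ᶜ-conj z@(a +i b) z∉ℝ⁻ =
    √-cong (R.*-congʳ (R.+-congʳ (∣conj∣ z))) , imaginary (R.compare b 0#)
    where
    open IsStrictTotalOrder R.isStrictTotalOrder using (irrefl; <-respˡ-≈)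

    X X′ : R.Carrier
    X  = (∣ z ∣ R.- a) R.* ½
    X′ = (∣ conj z ∣ R.- a) R.* ½

    X′≈X : R.√ X′ ≈ R.√ X
    X′≈X = √-cong (R.*-congʳ (R.+-congʳ (∣conj∣ z)))

    -b<0 : 0# < b → R.- b < 0#
    -b<0 0<b = R.undiff 0<b (R.sym (R.-‿inverseˡ b))

    imaginary : _ → im (√ᶜ (conj z)) ≈ R.- im (√ᶜ z)
    imaginary (tri< b<0 _ _) = R.trans
      (R.reflexive (if-no (R.- b R.<? 0#) λ -b<0 →
        R.<-irrefl (IsStrictTotalOrder.trans R.isStrictTotalOrder -b<0 (R.x<0⇒0<-x b<0))))
      (R.trans (R.trans X′≈X (R.sym (R.-‿involutive _)))
               (R.-‿cong (R.sym (R.reflexive (if-yes (b R.<? 0#) b<0)))))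
    imaginary (tri> b≮0 _ 0<b) = R.trans
      (R.reflexive (if-yes (R.- b R.<? 0#) (-b<0 0<b)))
      (R.-‿cong (R.trans X′≈X (R.sym (R.reflexive (if-no (b R.<? 0#) b≮0)))))
    imaginary (tri≈ b≮0 b≈0 _) = R.trans
      (R.reflexive (if-no (R.- b R.<? 0#) (irrefl (R.trans (R.-‿cong b≈0) R.-0#≈0#))))
      (R.trans (R.trans X′≈X √X≈0) (R.sym (R.trans
        (R.-‿cong (R.trans (R.reflexive (if-no (b R.<? 0#) b≮0)) √X≈0)) R.-0#≈0#)))
      where
      ∣z∣≈a : ∣ z ∣ ≈ a
      ∣z∣≈a = √-unique (R.≮⇒≥ λ a<0 → z∉ℝ⁻ (a<0 , b≈0))
        (R.sym (R.trans (R.+-congˡ (R.trans (R.*-congʳ b≈0) (R.zeroˡ b))) (R.+-identityʳ _)))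

      √X≈0 : R.√ X ≈ 0#
      √X≈0 = √0≈0 (R.trans (R.*-congʳ (R.trans (R.+-congʳ ∣z∣≈a) (R.-‿inverseʳ a))) (R.zeroˡ ½))

  -- With s = √z, both sides become z after multiplication by s, because s s̄ = |s|² = |z|.
  unit-*-√ᶜ-conj : ∀ {z} → ¬ z ≈ᶜ 0ᶜ → ¬ NegativeReal z → unit z *ᶜ √ᶜ (conj z) ≈ᶜ √ᶜ z
  unit-*-√ᶜ-conj {z} z≉0 z∉ℝ⁻ = *-cancelˡ-nonzero (√ᶜ-nonzero z≉0) (begin
    s *ᶜ (unit z *ᶜ √ᶜ (conj z))    ≈⟨ K.*-congˡ {s} (K.*-congˡ {unit z} (√ᶜ-conj z z∉ℝ⁻)) ⟩
    s *ᶜ (unit z *ᶜ conj s)         ≈⟨ exchange s (unit z) (conj s) ⟩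
    unit z *ᶜ (s *ᶜ conj s)         ≈⟨ K.*-congˡ {unit z} (*-conj s) ⟩
    unit z *ᶜ fromℝ (normSq s)      ≈⟨ K.*-congˡ {unit z} (fromℝ-cong ∣z∣≈) ⟨
    unit z *ᶜ modulus z             ≈⟨ unit-modulus z≉0 ⟩
    z                               ≈⟨ √ᶜ-square z ⟨
    s *ᶜ s                          ∎)
    where
    s : ℂ
    s = √ᶜ z

    exchange : ∀ x y z → x *ᶜ (y *ᶜ z) ≈ᶜ y *ᶜ (x *ᶜ z)
    exchange = T.solve 3 (λ x y z → x T.:* (y T.:* z) T.:= y T.:* (x T.:* z)) K.refl

    ∣z∣≈ : ∣ z ∣ ≈ normSq s
    ∣z∣≈ = √-unique (normSq-nonneg s)
      (R.trans (R.sym (normSq-* s s)) (normSq-cong (√ᶜ-square z)))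

-- Walks and distances.

least-spec : ∀ {n} {P : Pred (Fin n) 0ℓ} (P? : ∀ k → Dec (P k)) → ∃ P →
             ∃ λ k → toℕ k ≡ least P? × P k
least-spec {suc n} P? (k , Pk) with P? zero
least-spec {suc n} P? (k , Pk)       | yes P0 = zero , ≡.refl , P0
least-spec {suc n} P? (zero , P0)    | no ¬P0 = contradiction P0 ¬P0
least-spec {suc n} P? (suc k , Pk)   | no _   with least-spec (P? ∘ suc) (k , Pk)
... | l , eq , Pl = suc l , ≡.cong suc eq , Pl

module _ {n} {R : Rel (Fin n) 0ℓ} where

  -- Removing repeated vertices brings the length below n, so the search behind `distance` succeeds
  -- and its default value is not returned.
  distance-walk : (R? : Decidable R) → ∀ {i j} → Star R i j →
                  WalkOfLength (distance R? i j) i j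
  distance-walk R? {i} {j} w with toPath w
  ... | p , u with least-spec (λ k → walkOfLength? R? (toℕ k) i j)
                     (fromℕ< (path-length< p u) , p , ≡.sym (toℕ-fromℕ< (path-length< p u)))
  ...   | k , eq , q , len = q , ≡.trans len eq

  start∈vertices : ∀ {i j} (p : Star R i j) → i ∈ vertices p
  start∈vertices ε       = here ≡.refl
  start∈vertices (_ ◅ p) = here ≡.refl

  end∈vertices : ∀ {i j} (p : Star R i j) → j ∈ vertices p
  end∈vertices ε       = here ≡.refl
  end∈vertices (_ ◅ p) = there (end∈vertices p)

  closedPath-trivial : ∀ {i j} (p : Star R i j) → Unique (vertices p) → i ≡ j → length p ≡ 0
  closedPath-trivial ε       _         _      = ≡.refl
  closedPath-trivial (_ ◅ p) (i∉p ∷ _) ≡.refl = contradiction (end∈vertices p) (All¬⇒¬Any i∉p)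

vertices-map : ∀ {n} {R S : Rel (Fin n) 0ℓ} (f : ∀ {i j} → R i j → S i j) →
               ∀ {i j} (p : Star R i j) → vertices (Star.map f p) ≡ vertices p
vertices-map f ε       = ≡.refl
vertices-map f (_ ◅ p) = ≡.cong (_ List.∷_) (vertices-map f p)

-- Removing an edge from a unicyclic graph.

module GraphProperties {n m} (G : OrientedGraph n m) where

  open OrientedGraph G

  joins-irreflexive : ∀ {e x y} → Joins e x y → x ≢ y
  joins-irreflexive {e} (inj₁ (≡.refl , ≡.refl)) eq = loopless e eq
  joins-irreflexive {e} (inj₂ (≡.refl , ≡.refl)) eq = loopless e (≡.sym eq)

  joins-ends : ∀ {e x y u v} → Joins e x y → Joins e u v → u ≡ x × v ≡ y ⊎ u ≡ y × v ≡ x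
  joins-ends (inj₁ (≡.refl , ≡.refl)) (inj₁ (≡.refl , ≡.refl)) = inj₁ (≡.refl , ≡.refl)
  joins-ends (inj₁ (≡.refl , ≡.refl)) (inj₂ (≡.refl , ≡.refl)) = inj₂ (≡.refl , ≡.refl)
  joins-ends (inj₂ (≡.refl , ≡.refl)) (inj₁ (≡.refl , ≡.refl)) = inj₂ (≡.refl , ≡.refl)
  joins-ends (inj₂ (≡.refl , ≡.refl)) (inj₂ (≡.refl , ≡.refl)) = inj₁ (≡.refl , ≡.refl)

  joins-unique : ∀ {e f x y} → Joins e x y → Joins f x y → e ≡ f
  joins-unique j (inj₁ (≡.refl , ≡.refl)) = simple j
  joins-unique j (inj₂ (≡.refl , ≡.refl)) = simple (swap j)

  joins-self : ∀ e → Joins e (src e) (tgt e)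
  joins-self e = inj₁ (≡.refl , ≡.refl)

  forget : ∀ {e x y} → AdjWithout e x y → Adj x y
  forget (f , _ , j) = f , j

  adjWithout-sym : ∀ {e} → Symmetric (AdjWithout e)
  adjWithout-sym (f , f≢e , j) = f , f≢e , swap j

  reverse : ∀ {e x y} → Star (AdjWithout e) x y → Star (AdjWithout e) y x
  reverse = Star.reverse adjWithout-sym

  traverses-◅◅ : ∀ {e x y z} (p : Star Adj x y) {q : Star Adj y z} →
                 Traverses e (p ◅◅ q) → Traverses e p ⊎ Traverses e q
  traverses-◅◅ ε       t        = inj₂ t
  traverses-◅◅ (_ ◅ p) (inj₁ t) = inj₁ (inj₁ t)
  traverses-◅◅ (_ ◅ p) (inj₂ t) with traverses-◅◅ p t
  ... | inj₁ t′ = inj₁ (inj₂ t′)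
  ... | inj₂ t′ = inj₂ t′

  traverses-◅◅ʳ : ∀ {e x y z} (p : Star Adj x y) {q : Star Adj y z} →
                  Traverses e q → Traverses e (p ◅◅ q)
  traverses-◅◅ʳ ε       t = t
  traverses-◅◅ʳ (_ ◅ p) t = inj₂ (traverses-◅◅ʳ p t)

  forget-avoids : ∀ {e x y} (p : Star (AdjWithout e) x y) → ¬ Traverses e (Star.map forget p)
  forget-avoids ((f , f≢e , _) ◅ p) (inj₁ e≡f) = f≢e (≡.sym e≡f)
  forget-avoids (_ ◅ p)             (inj₂ t)   = forget-avoids p t

  traversed-end : ∀ {e x y u v} (p : Star Adj x y) → Traverses e p → Joins e u v → u ∈ vertices p
  traversed-end ((f , j) ◅ p) (inj₁ ≡.refl) j′ with joins-ends j j′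
  ... | inj₁ (≡.refl , _) = here ≡.refl
  ... | inj₂ (≡.refl , _) = there (start∈vertices p)
  traversed-end (_ ◅ p) (inj₂ t) j′ = there (traversed-end p t j′)

  restrict : ∀ {e x y} (p : Star Adj x y) → ¬ Traverses e p → Star (AdjWithout e) x y
  restrict ε             _  = ε
  restrict ((f , j) ◅ p) ¬t = (f , (λ f≡e → ¬t (inj₁ (≡.sym f≡e))) , j) ◅ restrict p (¬t ∘ inj₂)

  -- The walk is the tail of `p` that starts at f or just after it, according to the direction in
  -- which `p` passes f.
  restrictFrom : ∀ {e f x y u v} (p : Star Adj x y) → ¬ Traverses e p → Traverses f p →
                 Joins f u v → Star (AdjWithout e) u y
  restrictFrom ((f , j) ◅ p) ¬t (inj₁ ≡.refl) j′ with joins-ends j j′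
  ... | inj₁ (≡.refl , _) = restrict ((f , j) ◅ p) ¬t
  ... | inj₂ (≡.refl , _) = restrict p (¬t ∘ inj₂)
  restrictFrom (_ ◅ p) ¬t (inj₂ t) j′ = restrictFrom p (¬t ∘ inj₂) t j′

  -- Every passage along e is replaced by `d` or its reverse.
  detour : ∀ {e x y u v} → Joins e u v → Star (AdjWithout e) u v → Star Adj x y →
           Star (AdjWithout e) x y
  detour j d ε = ε
  detour {e} j d ((f , j′) ◅ p) with f ≟ᶠ e
  ... | no f≢e = (f , f≢e , j′) ◅ detour j d p
  ... | yes ≡.refl with joins-ends j j′
  ...   | inj₁ (≡.refl , ≡.refl) = d ◅◅ detour j d p
  ...   | inj₂ (≡.refl , ≡.refl) = reverse d ◅◅ detour j d p

  -- The component of i in G - e contains no cycle. A cycle avoiding e lies in a single component,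
  -- so it is enough to locate its base.
  Acyclic : Fin m → Fin n → Set
  Acyclic e i = ∀ D → ¬ e ∈ᶜ D → ¬ Star (AdjWithout e) i (base D)

  acyclic-walk : ∀ {e i j} → Star (AdjWithout e) i j → Acyclic e i → Acyclic e j
  acyclic-walk p acyclic D e∉D q = acyclic D e∉D (p ◅◅ q)

  module _ (U : Unicyclic) where

    open Unicyclic U renaming (cycle to C)

    -- By uniqueness every cycle has the edges of C, so none avoids e.
    acyclic-onCycle : ∀ {e} → e ∈ᶜ C → ∀ i → Acyclic e i
    acyclic-onCycle {e} e∈C i D e∉D _ = e∉D (Equivalence.from (unique D e) e∈C)

    -- A cycle D reachable from i has the edges of C, so its base is an end of an edge of C. From
    -- there C leads to its own base without using e, which would put i in the unicyclic part.
    acyclic-tree : ∀ {e i} → ¬ e ∈ᶜ C → ¬ InUnicyclicPart C e i → Acyclic e i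
    acyclic-tree {e} e∉C i∉part D e∉D p =
      i∉part (p ◅◅ restrictFrom (closedWalk C) e∉C f∈C (swap (proj₂ closing)))
      where
      open Cycle D using (path; closing)
      f : Fin m
      f = proj₁ closing
      f∈C : f ∈ᶜ C
      f∈C = Equivalence.to (unique D f) (traverses-◅◅ʳ path (inj₁ ≡.refl))

    -- Read backwards from the base of C, a walk stays in the unicyclic part until it meets e, and
    -- then an end of e lies in that part.
    part-meets-edge : ∀ e → InUnicyclicPart C e (src e) ⊎ InUnicyclicPart C e (tgt e)
    part-meets-edge e = [ inj₁ , id ]′ (meets (connected (src e) (base C)))
      where
      meets : ∀ {i} → Star Adj i (base C) →
              InUnicyclicPart C e i ⊎ InUnicyclicPart C e (src e) ⊎ InUnicyclicPart C e (tgt e)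
      meets ε = inj₁ ε
      meets ((f , j) ◅ p) with meets p
      ... | inj₂ q = inj₂ q
      ... | inj₁ q with f ≟ᶠ e
      ...   | no f≢e = inj₁ ((f , f≢e , j) ◅ q)
      ...   | yes ≡.refl with joins-ends (joins-self f) j
      ...     | inj₁ (≡.refl , ≡.refl) = inj₂ (inj₂ q)
      ...     | inj₂ (≡.refl , ≡.refl) = inj₂ (inj₁ q)

    -- A walk joining the ends of e and avoiding e closes up with e to a cycle.
    bridge : ∀ {e x y} → ¬ e ∈ᶜ C → Joins e x y → ¬ Star (AdjWithout e) x y
    bridge {e} e∉C j w with toPath w
    ... | ε , _ = joins-irreflexive j ≡.refl
    ... | (f , f≢e , j′) ◅ ε , _ = f≢e (joins-unique j′ j)
    ... | p@(_ ◅ _ ◅ _) , u = e∉C (Equivalence.to (unique D e) (traverses-◅◅ʳ (Cycle.path D) (inj₁ ≡.refl)))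
      where
      D : Cycle
      D = record
        { path    = Star.map forget p
        ; isPath  = ≡.subst Unique (≡.sym (vertices-map forget p)) u
        ; long    = s≤s (s≤s z≤n)
        ; closing = e , swap j }

    ends-separated : ∀ {e} → ¬ e ∈ᶜ C →
                     ¬ (InUnicyclicPart C e (src e) × InUnicyclicPart C e (tgt e))
    ends-separated e∉C (p , q) = bridge e∉C (joins-self _) (p ◅◅ reverse q)

-- Gains of walks and their independence of the walk.

module Gain (M : CommutativeMonoid 0ℓ 0ℓ) {n}
            (g : Fin n → Fin n → CommutativeMonoid.Carrier M) where

  open CommutativeMonoid M renaming (ε to 1#)
  open SetoidReasoning setoid

  -- For the constant `g` = -1 this is the parity sign of the length; for the unit weights of edges
  -- it is the unit weight of the walk.
  gain : ∀ {R : Rel (Fin n) 0ℓ} {i j} → Star R i j → Carrier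
  gain ε                 = 1#
  gain (_◅_ {i} {j} _ p) = g i j ∙ gain p

  gain-◅◅ : ∀ {R : Rel (Fin n) 0ℓ} {i j k} (p : Star R i j) (q : Star R j k) →
            gain (p ◅◅ q) ≈ gain p ∙ gain q
  gain-◅◅ ε       q = sym (identityˡ _)
  gain-◅◅ (_ ◅ p) q = trans (∙-congˡ (gain-◅◅ p q)) (sym (assoc _ _ _))

  -- The inclusion of vertices carries the induction: it keeps the first piece a path when a step is
  -- put in front of it.
  splitAt : ∀ {R : Rel (Fin n) 0ℓ} {i j k} (p : Star R i j) → Unique (vertices p) → k ∈ vertices p →
            Σ (Path R i k) λ (q , _) → Σ (Path R k j) λ (r , _) →
            (∀ {v} → v ∈ vertices q → v ∈ vertices p) × gain p ≈ gain q ∙ gain r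
  splitAt ε u (here ≡.refl) = (ε , [] ∷ []) , (ε , u) , id , sym (identityˡ _)
  splitAt (x ◅ p) u (here ≡.refl) =
    (ε , [] ∷ []) , (x ◅ p , u) , (λ { (here ≡.refl) → here ≡.refl }) , sym (identityˡ _)
  splitAt (x ◅ p) (i∉p ∷ u) (there k∈p) with splitAt p u k∈p
  ... | (q , uq) , r , q⊆p , eq =
    (x ◅ q , All.tabulate (λ v∈q → All.lookup i∉p (q⊆p v∈q)) ∷ uq) , r ,
    (λ { (here ≡.refl) → here ≡.refl ; (there v∈q) → there (q⊆p v∈q) }) ,
    trans (∙-congˡ eq) (sym (assoc _ _ _))

  module _ {m} (G : OrientedGraph n m) where

    open OrientedGraph G
    open GraphProperties G

    gain-restrict : ∀ {e i j} (p : Star Adj i j) (¬t : ¬ Traverses e p) →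
                    gain (restrict p ¬t) ≡ gain p
    gain-restrict ε       _  = ≡.refl
    gain-restrict (_ ◅ p) ¬t = ≡.cong (g _ _ ∙_) (gain-restrict p (¬t ∘ inj₂))

    -- A path uses e at most once, since a second use would visit an end of e again; so both pieces
    -- avoid e.
    splitPath : ∀ {e i j} (p : Star Adj i j) → Unique (vertices p) → Traverses e p →
      ∃₂ λ x y → Joins e x y × Σ (Star (AdjWithout e) i x) λ q → Σ (Star (AdjWithout e) y j) λ r →
      gain p ≈ gain q ∙ (g x y ∙ gain r)
    splitPath {e} {i} ((f , j) ◅ p) (i∉p ∷ u) t with f ≟ᶠ e
    ... | yes ≡.refl = _ , _ , j , ε , restrict p ¬t ,
      sym (trans (identityˡ _) (∙-congˡ (reflexive (gain-restrict p ¬t))))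
      where
      ¬t : ¬ Traverses e p
      ¬t t′ = All¬⇒¬Any i∉p (traversed-end p t′ j)
    splitPath ((f , j) ◅ p) (i∉p ∷ u) (inj₁ e≡f) | no f≢e = contradiction (≡.sym e≡f) f≢e
    splitPath ((f , j) ◅ p) (i∉p ∷ u) (inj₂ t)   | no f≢e with splitPath p u t
    ... | x , y , jxy , q , r , eq =
      x , y , jxy , (f , f≢e , j) ◅ q , r , trans (∙-congˡ eq) (sym (assoc _ _ _))

    -- By commutativity the gain of a closed walk does not depend on its starting point, so the
    -- cycle can be rotated to begin with e.
    openCycle : ∀ {e} C → e ∈ᶜ C →
      ∃₂ λ x y → Joins e x y × Σ (Star (AdjWithout e) y x) λ q → gain (closedWalk C) ≈ g x y ∙ gain q
    openCycle {e} C e∈C with proj₁ (Cycle.closing C) ≟ᶠ e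
    ... | yes ≡.refl = _ , _ , proj₂ closing , restrict path ¬t , (begin
      gain (path ◅◅ (closing ◅ ε))              ≈⟨ gain-◅◅ path (closing ◅ ε) ⟩
      gain path ∙ (g _ _ ∙ 1#)                  ≈⟨ ∙-congˡ (identityʳ _) ⟩
      gain path ∙ g _ _                         ≈⟨ comm _ _ ⟩
      g _ _ ∙ gain path                         ≡⟨ ≡.cong (g _ _ ∙_) (gain-restrict path ¬t) ⟨
      g _ _ ∙ gain (restrict path ¬t)           ∎)
      where
      open Cycle C using (path; closing; isPath; long)

      -- If e were the first step, the path would already be at its end, too early for `long`. If e
      -- came later, the path would return to its start.
      avoids : ∀ {x y} (p : Star Adj x y) → Unique (vertices p) → 2 ℕ.≤ length p →
               Joins e y x → ¬ Traverses e p
      avoids ((f , j) ◅ p) (_ ∷ u) long j′ (inj₁ ≡.refl) with joins-ends j j′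
      ... | inj₁ (_ , x≡k)    = joins-irreflexive j x≡k
      ... | inj₂ (≡.refl , _) with closedPath-trivial p u ≡.refl
      ...   | len≡0 rewrite len≡0 = contradiction long λ { (s≤s ()) }
      avoids (_ ◅ p) (x∉p ∷ _) long j′ (inj₂ t) = All¬⇒¬Any x∉p (traversed-end p t (swap j′))

      ¬t : ¬ Traverses e path
      ¬t = avoids path isPath long (proj₂ closing)
    ... | no c≢e with splitPath (Cycle.path C) (Cycle.isPath C)
                        ([ id , (λ { (inj₁ e≡c) → contradiction (≡.sym e≡c) c≢e }) ]
                         (traverses-◅◅ (Cycle.path C) e∈C))
    ...   | x , y , j , q , r , eq =
      -- From y to the end of the path, over the closing edge to the base, and along the path to x.
      x , y , j , r ◅◅ (closing ◅ q) , (begin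
      gain (path ◅◅ (Cycle.closing C ◅ ε))      ≈⟨ gain-◅◅ path (Cycle.closing C ◅ ε) ⟩
      gain path ∙ (g _ _ ∙ 1#)                  ≈⟨ ∙-cong eq (identityʳ _) ⟩
      gain q ∙ (g x y ∙ gain r) ∙ g _ _         ≈⟨ assoc _ _ _ ⟩
      gain q ∙ (g x y ∙ gain r ∙ g _ _)         ≈⟨ comm _ _ ⟩
      g x y ∙ gain r ∙ g _ _ ∙ gain q           ≈⟨ trans (assoc _ _ _) (assoc _ _ _) ⟩
      g x y ∙ (gain r ∙ (g _ _ ∙ gain q))       ≈⟨ ∙-congˡ (gain-◅◅ r (closing ◅ q)) ⟨
      g x y ∙ gain (r ◅◅ (closing ◅ q))         ∎)
      where
      open Cycle C using (path)
      closing : AdjWithout e (Cycle.end C) (base C)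
      closing = proj₁ (Cycle.closing C) , c≢e , proj₂ (Cycle.closing C)

    module Invertible (inverse : ∀ {x y} → Adj x y → g x y ∙ g y x ≈ 1#) where

      -- A path `q` with two or more steps would close up with `x` to a cycle avoiding e. Hence `q`
      -- is one step back from k to i, and the two gains are inverse.
      backtrack : ∀ {e i k} → AdjWithout e i k → (q : Star (AdjWithout e) k i) →
                  Unique (vertices q) → Acyclic e i → g i k ∙ gain q ≈ 1#
      backtrack x ε             _ _       = contradiction ≡.refl (joins-irreflexive (proj₂ (forget x)))
      backtrack x (_ ◅ ε)       _ _       = trans (∙-congˡ (identityʳ _)) (inverse (forget x))
      backtrack {e} x q@(_ ◅ _ ◅ _) u acyclic = ⊥-elim (acyclic D e∉D (x ◅ ε))
        where
        D : Cycle
        D = record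
          { path    = Star.map forget q
          ; isPath  = ≡.subst Unique (≡.sym (vertices-map forget q)) u
          ; long    = s≤s (s≤s z≤n)
          ; closing = forget x }

        e∉D : ¬ e ∈ᶜ D
        e∉D t with traverses-◅◅ (Star.map forget q) t
        ... | inj₁ t′          = forget-avoids q t′
        ... | inj₂ (inj₁ e≡f)  = proj₁ (proj₂ x) (≡.sym e≡f)

      -- When a step is put in front of a path that already visits i, the step and the piece of the
      -- path back to i form a loop. By `backtrack` its gain is 1, so cutting it off changes
      -- nothing.
      eraseLoops : ∀ {e i j} (w : Star (AdjWithout e) i j) → Acyclic e i →
                   Σ (Path (AdjWithout e) i j) λ (p , _) → gain p ≈ gain w
      eraseLoops ε _ = (ε , [] ∷ []) , refl
      eraseLoops {i = i} (x ◅ w) acyclic with eraseLoops w (acyclic-walk (x ◅ ε) acyclic)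
      ... | (p , u) , eq with DecMembership._∈?_ _≟ᶠ_ i (vertices p)
      ...   | no i∉p = (x ◅ p , ¬Any⇒All¬ (vertices p) i∉p ∷ u) , ∙-congˡ eq
      ...   | yes i∈p with splitAt p u i∈p
      ...     | (q , uq) , (r , ur) , _ , p≈qr = (r , ur) , (begin
        gain r                       ≈⟨ identityˡ _ ⟨
        1# ∙ gain r                  ≈⟨ ∙-congʳ (backtrack x q uq acyclic) ⟨
        g _ _ ∙ gain q ∙ gain r      ≈⟨ assoc _ _ _ ⟩
        g _ _ ∙ (gain q ∙ gain r)    ≈⟨ ∙-congˡ p≈qr ⟨
        g _ _ ∙ gain p               ≈⟨ ∙-congˡ eq ⟩
        g _ _ ∙ gain w               ∎)

      -- Erasing the loops of a closed walk leaves the one-vertex walk.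
      gain-closed : ∀ {e i} (w : Star (AdjWithout e) i i) → Acyclic e i → gain w ≈ 1#
      gain-closed w acyclic with eraseLoops w acyclic
      ... | (ε , _) , eq = sym eq
      ... | (x ◅ p , i∉p ∷ _) , _ = contradiction (end∈vertices p) (All¬⇒¬Any i∉p)

      -- Both `p` and `q` form closed walks with the reverse of `q`, so both gains are inverse to
      -- the gain of that reverse.
      gain-unique : ∀ {e i j} → Acyclic e i → (p q : Star (AdjWithout e) i j) → gain p ≈ gain q
      gain-unique acyclic p q = begin
        gain p                                   ≈⟨ identityʳ _ ⟨
        gain p ∙ 1#                              ≈⟨ ∙-congˡ (closed (reverse q) q (acyclic-walk p acyclic)) ⟨
        gain p ∙ (gain (reverse q) ∙ gain q)     ≈⟨ assoc _ _ _ ⟨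
        gain p ∙ gain (reverse q) ∙ gain q       ≈⟨ ∙-congʳ (closed p (reverse q) acyclic) ⟩
        1# ∙ gain q                              ≈⟨ identityˡ _ ⟩
        gain q                                   ∎
        where
        closed : ∀ {e i j} (p : Star (AdjWithout e) i j) (q : Star (AdjWithout e) j i) → Acyclic e i →
                 gain p ∙ gain q ≈ 1#
        closed p q acyclic = trans (sym (gain-◅◅ p q)) (gain-closed (p ◅◅ q) acyclic)

      -- The two directions around C have inverse gains.
      cycle-gain : ∀ {e} (U : Unicyclic) → let C = Unicyclic.cycle U in e ∈ᶜ C →
        (γ : Star (AdjWithout e) (src e) (tgt e)) →
        let c = g (tgt e) (src e) ∙ gain γ in
        gain (closedWalk C) ≈ c ⊎ gain (closedWalk C) ∙ c ≈ 1#
      cycle-gain {e} U e∈C γ with openCycle (Unicyclic.cycle U) e∈C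
      ... | _ , _ , inj₂ (≡.refl , ≡.refl) , q , eq =
        inj₁ (trans eq (∙-congˡ (gain-unique (acyclic-onCycle U e∈C _) q γ)))
      ... | _ , _ , inj₁ (≡.refl , ≡.refl) , q , eq = inj₂ (begin
        gain (closedWalk (Unicyclic.cycle U)) ∙ (g _ _ ∙ gain γ)  ≈⟨ ∙-congʳ eq ⟩
        g _ _ ∙ gain q ∙ (g _ _ ∙ gain γ)        ≈⟨ assoc _ _ _ ⟩
        g _ _ ∙ (gain q ∙ (g _ _ ∙ gain γ))      ≈⟨ ∙-congˡ (trans (∙-congˡ (comm _ _)) (sym (assoc _ _ _))) ⟩
        g _ _ ∙ (gain q ∙ gain γ ∙ g _ _)        ≈⟨ ∙-congˡ (∙-congʳ (gain-◅◅ q γ)) ⟨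
        g _ _ ∙ (gain (q ◅◅ γ) ∙ g _ _)          ≈⟨ ∙-congˡ (∙-congʳ (gain-closed (q ◅◅ γ) (acyclic-onCycle U e∈C _))) ⟩
        g _ _ ∙ (1# ∙ g _ _)                     ≈⟨ ∙-congˡ (identityˡ _) ⟩
        g _ _ ∙ g _ _                            ≈⟨ inverse (e , joins-self e) ⟩
        1#                                       ∎)

      -- An element and its inverse are trivial together, so it does not matter in which direction C
      -- happens to be given.
      cycle-gain-trivial⇒ : ∀ {e} (U : Unicyclic) → let C = Unicyclic.cycle U in e ∈ᶜ C →
        (γ : Star (AdjWithout e) (src e) (tgt e)) →
        gain (closedWalk C) ≈ 1# → g (tgt e) (src e) ∙ gain γ ≈ 1#
      cycle-gain-trivial⇒ U e∈C γ C≈1 with cycle-gain U e∈C γ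
      ... | inj₁ eq = trans (sym eq) C≈1
      ... | inj₂ eq = trans (sym (identityˡ _)) (trans (∙-congʳ (sym C≈1)) eq)

      cycle-gain-trivial⇐ : ∀ {e} (U : Unicyclic) → let C = Unicyclic.cycle U in e ∈ᶜ C →
        (γ : Star (AdjWithout e) (src e) (tgt e)) →
        g (tgt e) (src e) ∙ gain γ ≈ 1# → gain (closedWalk C) ≈ 1#
      cycle-gain-trivial⇐ U e∈C γ c≈1 with cycle-gain U e∈C γ
      ... | inj₁ eq = trans eq c≈1
      ... | inj₂ eq = trans (sym (identityʳ _)) (trans (∙-congˡ (sym c≈1)) eq)

-- Signs and unit weights in G - e.

module Inverse (ℝ : CompleteOrderedField) {n} (G : OrientedGraph n n)
  (U : OrientedGraph.Unicyclic G) (w : Fin n → Complex.ℂ ℝ)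
  (w≉0 : ∀ e → ¬ Complex._≈ᶜ_ ℝ (w e) (Complex.0ᶜ ℝ))
  (w∉ℝ⁻ : ∀ e → ¬ Complex.NegativeReal ℝ (w e)) where

  open Complex ℝ
  open ComplexProperties ℝ
  open FieldProperties ℂ-field
  open LinearAlgebra ℂ-field
  open OrientedGraph G
  open GraphProperties G
  open Unicyclic U renaming (cycle to C)
  open Weighted ℝ G w hiding (unit)
  private
    module K = CommutativeRing ℂ-commutativeRing
    module T = SemiringSolver K.commutativeSemiring
  open SetoidReasoning K.setoid

  a-edge : ∀ e → a (src e) (tgt e) ≡ w e
  a-edge e with any? (λ f → src f ≟ᶠ src e ×-dec tgt f ≟ᶠ tgt e)
              | any? (λ f → src f ≟ᶠ tgt e ×-dec tgt f ≟ᶠ src e)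
  ... | yes (f , j) | _ = ≡.cong w (joins-unique (inj₁ j) (joins-self e))
  ... | no ¬j       | _ = contradiction (e , ≡.refl , ≡.refl) ¬j

  -- `a` first looks for an edge directed from `tgt e` to `src e`. By simplicity it would be e
  -- itself, and e would be a loop.
  a-reversed : ∀ e → a (tgt e) (src e) ≡ conj (w e)
  a-reversed e with any? (λ f → src f ≟ᶠ tgt e ×-dec tgt f ≟ᶠ src e)
                  | any? (λ f → src f ≟ᶠ src e ×-dec tgt f ≟ᶠ tgt e)
  ... | yes (f , p , q) | _ with joins-unique {f} (inj₂ (p , q)) (joins-self e)
  ...   | ≡.refl = contradiction p (loopless e)
  a-reversed e | no _ | yes (f , j) = ≡.cong (conj ∘ w) (joins-unique (inj₁ j) (joins-self e))
  a-reversed e | no _ | no ¬j       = contradiction (e , ≡.refl , ≡.refl) ¬j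

  a-nonzero : ∀ {x y} → Adj x y → ¬ a x y ≈ᶜ 0ᶜ
  a-nonzero (e , inj₁ (≡.refl , ≡.refl)) = ≡.subst (λ z → ¬ z ≈ᶜ 0ᶜ) (≡.sym (a-edge e)) (w≉0 e)
  a-nonzero (e , inj₂ (≡.refl , ≡.refl)) =
    ≡.subst (λ z → ¬ z ≈ᶜ 0ᶜ) (≡.sym (a-reversed e)) (conj-nonzero (w≉0 e))

  -1ᶜ : ℂ
  -1ᶜ = -ᶜ 1ᶜ

  -1*-1≈1 : -1ᶜ *ᶜ -1ᶜ ≈ᶜ 1ᶜ
  -1*-1≈1 = K.trans (K.sym (RingProperties.-‿distribˡ-* K.ring 1ᶜ -1ᶜ))
    (K.trans (K.-‿cong (K.*-identityˡ -1ᶜ)) (RingProperties.-‿involutive K.ring 1ᶜ))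

  minusOne : Fin n → Fin n → ℂ
  minusOne _ _ = -1ᶜ

  minusOne-inverse : ∀ {x y} → Adj x y → minusOne x y *ᶜ minusOne y x ≈ᶜ 1ᶜ
  minusOne-inverse _ = -1*-1≈1

  -- unitOf and entry are opaque because comparing their values up to unfolding is
  -- prohibitively expensive.
  opaque
    unitOf : Fin n → Fin n → ℂ
    unitOf x y = unit (a x y)

    unitOf-def : ∀ x y → unitOf x y ≡ unit (a x y)
    unitOf-def x y = ≡.refl

  unitOf-edge : ∀ e → unitOf (src e) (tgt e) ≡ unit (w e)
  unitOf-edge e = ≡.trans (unitOf-def (src e) (tgt e)) (≡.cong unit (a-edge e))

  unitOf-reversed : ∀ e → unitOf (tgt e) (src e) ≡ unit (conj (w e))
  unitOf-reversed e = ≡.trans (unitOf-def (tgt e) (src e)) (≡.cong unit (a-reversed e))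

  unitOf-inverse : ∀ {x y} → Adj x y → unitOf x y *ᶜ unitOf y x ≈ᶜ 1ᶜ
  unitOf-inverse (e , inj₁ (≡.refl , ≡.refl)) =
    ≡.subst₂ (λ z z′ → z *ᶜ z′ ≈ᶜ 1ᶜ) (≡.sym (unitOf-edge e)) (≡.sym (unitOf-reversed e))
      (unit-conj (w≉0 e))
  unitOf-inverse (e , inj₂ (≡.refl , ≡.refl)) = K.trans
    (K.*-comm (unitOf (tgt e) (src e)) (unitOf (src e) (tgt e)))
    (unitOf-inverse (e , inj₁ (≡.refl , ≡.refl)))

  private
    module Parity where
      open Gain K.*-commutativeMonoid minusOne public
      open Invertible G minusOne-inverse public
    module Phase where
      open Gain K.*-commutativeMonoid unitOf public
      open Invertible G unitOf-inverse public

  parity-length : ∀ {R : Rel (Fin n) 0ℓ} {x y} (p : Star R x y) → Parity.gain p ≡ -1ᶜ ^ᶜ length p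
  parity-length ε       = ≡.refl
  parity-length (_ ◅ p) = ≡.cong (-1ᶜ *ᶜ_) (parity-length p)

  parity-even : ∀ k → -1ᶜ ^ᶜ (k ℕ.* 2) ≈ᶜ 1ᶜ
  parity-even zero    = K.refl
  parity-even (suc k) = K.trans (K.sym (K.*-assoc -1ᶜ -1ᶜ _))
    (K.trans (K.*-cong -1*-1≈1 (parity-even k)) (K.*-identityˡ 1ᶜ))

  wt-nonzero : ∀ {R : Rel (Fin n) 0ℓ} → (∀ {x y} → R x y → Adj x y) →
               ∀ {x y} (p : Star R x y) → ¬ wt p ≈ᶜ 0ᶜ
  wt-nonzero R⇒Adj ε       = DiscreteField.1≉0 ℂ-field
  wt-nonzero R⇒Adj (r ◅ p) = *-nonzero (a-nonzero (R⇒Adj r)) (wt-nonzero R⇒Adj p)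

  unit-wt : ∀ {R : Rel (Fin n) 0ℓ} → (∀ {x y} → R x y → Adj x y) →
            ∀ {x y} (p : Star R x y) → unit (wt p) ≈ᶜ Phase.gain p
  unit-wt R⇒Adj ε       = unit-1
  unit-wt R⇒Adj (_◅_ {x} {y} r p) = begin
    unit (a x y *ᶜ wt p)              ≈⟨ unit-* (a-nonzero (R⇒Adj r)) (wt-nonzero R⇒Adj p) ⟩
    unit (a x y) *ᶜ unit (wt p)       ≡⟨ ≡.cong (_*ᶜ unit (wt p)) (unitOf-def x y) ⟨
    unitOf x y *ᶜ unit (wt p)         ≈⟨ K.*-congˡ {unitOf x y} (unit-wt R⇒Adj p) ⟩
    unitOf x y *ᶜ Phase.gain p        ∎

  module _ {e : Fin n} where

    -- `d*` is the length of one walk avoiding e, and in the absence of cycles all walks with these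
    -- ends have the same parity.
    sign-walk : ∀ {x y} → Acyclic e x → (p : Star (AdjWithout e) x y) → sign e x y ≈ᶜ Parity.gain p
    sign-walk acyclic p with distance-walk (adjWithout? e) p
    ... | q , len = begin
      -1ᶜ ^ᶜ d* e _ _    ≡⟨ ≡.cong (-1ᶜ ^ᶜ_) len ⟨
      -1ᶜ ^ᶜ length q    ≡⟨ parity-length q ⟨
      Parity.gain q      ≈⟨ Parity.gain-unique acyclic q p ⟩
      Parity.gain p      ∎

    wtγ-walk : ∀ {x y} → Star (AdjWithout e) x y →
               ∃ λ (q : Star (AdjWithout e) x y) → wtγ e x y ≡ wt q
    wtγ-walk {x} {y} p with path? (adjWithout? e) x y
    ... | yes (q , _) = q , ≡.refl
    ... | no ¬path    = contradiction (toPath p) ¬path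

    wtγ-nonzero : ∀ {x y} → Star (AdjWithout e) x y → ¬ wtγ e x y ≈ᶜ 0ᶜ
    wtγ-nonzero {x} {y} p = lemma (wtγ-walk p)
      where
      lemma : ∀ {z} → (∃ λ (q : Star (AdjWithout e) x y) → z ≡ wt q) → ¬ z ≈ᶜ 0ᶜ
      lemma (q , ≡.refl) = wt-nonzero forget q

    unit-wtγ : ∀ {x y} → Acyclic e x → (p : Star (AdjWithout e) x y) →
               unit (wtγ e x y) ≈ᶜ Phase.gain p
    unit-wtγ {x} {y} acyclic p = lemma (wtγ-walk p)
      where
      lemma : ∀ {z} → (∃ λ (q : Star (AdjWithout e) x y) → z ≡ wt q) → unit z ≈ᶜ Phase.gain p
      lemma (q , ≡.refl) = begin
        unit (wt q)     ≈⟨ unit-wt forget q ⟩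
        Phase.gain q    ≈⟨ Phase.gain-unique acyclic q p ⟩
        Phase.gain p    ∎

    phase⁻¹ : Fin n → Fin n → ℂ
    phase⁻¹ x y = modulus (wtγ e x y) /ᶜ wtγ e x y

    phase⁻¹-walk : ∀ {x y} → Acyclic e x → (p : Star (AdjWithout e) x y) →
                   phase⁻¹ x y *ᶜ Phase.gain p ≈ᶜ 1ᶜ
    phase⁻¹-walk {x} {y} acyclic p = K.trans
      (K.*-congˡ {phase⁻¹ x y} (K.sym (unit-wtγ acyclic p))) (modulus/-unit (wtγ-nonzero p))

    -- The walk from y back to x and on along `p` has phase `ω′` `g`, which `ρy` inverts, while `ρx`
    -- inverts `g` and `ω` inverts `ω′`. Tree entries use the inverse phase of a walk towards the
    -- root and cycle entries the phase of a walk away from it, so both pick up the same factor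
    -- `unitOf x y`.
    phase⁻¹-step : ∀ {x y z} → Acyclic e x → AdjWithout e x y → Star (AdjWithout e) x z →
                   phase⁻¹ y z ≈ᶜ phase⁻¹ x z *ᶜ unitOf x y
    phase⁻¹-step {x} {y} {z} acyclic r p = begin
      ρy                                      ≈⟨ K.*-identityʳ ρy ⟨
      ρy *ᶜ 1ᶜ                                ≈⟨ K.*-congˡ {ρy} one ⟨
      ρy *ᶜ (ρx *ᶜ g *ᶜ (ω *ᶜ ω′))            ≈⟨ regroup ρy ρx g ω ω′ ⟩
      ρy *ᶜ (ω′ *ᶜ g) *ᶜ (ρx *ᶜ ω)            ≈⟨ K.*-congʳ {ρx *ᶜ ω} (phase⁻¹-walk (acyclic-walk (r ◅ ε) acyclic)
                                                    (adjWithout-sym r ◅ p)) ⟩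
      1ᶜ *ᶜ (ρx *ᶜ ω)                         ≈⟨ K.*-identityˡ (ρx *ᶜ ω) ⟩
      ρx *ᶜ ω                                 ∎
      where
      ρx ρy g ω ω′ : ℂ
      ρx = phase⁻¹ x z
      ρy = phase⁻¹ y z
      g  = Phase.gain p
      ω  = unitOf x y
      ω′ = unitOf y x

      one : ρx *ᶜ g *ᶜ (ω *ᶜ ω′) ≈ᶜ 1ᶜ
      one = K.trans (K.*-cong (phase⁻¹-walk acyclic p) (unitOf-inverse (forget r))) (K.*-identityˡ 1ᶜ)

      regroup : ∀ ρy ρx g ω ω′ → ρy *ᶜ (ρx *ᶜ g *ᶜ (ω *ᶜ ω′)) ≈ᶜ ρy *ᶜ (ω′ *ᶜ g) *ᶜ (ρx *ᶜ ω)
      regroup = T.solve 5 (λ ρy ρx g ω ω′ →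
        ρy T.:* (ρx T.:* g T.:* (ω T.:* ω′)) T.:= ρy T.:* (ω′ T.:* g) T.:* (ρx T.:* ω)) K.refl

    sign-step : ∀ {x y z} → Acyclic e x → AdjWithout e x y → Star (AdjWithout e) x z →
                sign e y z ≈ᶜ -1ᶜ *ᶜ sign e x z
    sign-step acyclic r p = K.trans
      (sign-walk (acyclic-walk (r ◅ ε) acyclic) (adjWithout-sym r ◅ p))
      (K.*-congˡ { -1ᶜ } (K.sym (sign-walk acyclic p)))

  -- Multiplication by a column of the incidence matrix.

  s s* : Fin n → ℂ
  s  e = √ᶜ (w e)
  s* e = √ᶜ (conj (w e))

  -- Written with two rows of the identity matrix, so that a sum over j picks out the ends of f.
  -- They are distinct rows because f is not a loop.
  incidence-split : ∀ f j z → z *ᶜ incidence j f ≈ᶜ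
    identity (src f) j *ᶜ (z *ᶜ s f) +ᶜ identity (tgt f) j *ᶜ (z *ᶜ s* f)
  incidence-split f j z with src f ≟ᶠ j | tgt f ≟ᶠ j
  ... | yes p | yes q = contradiction (≡.trans p (≡.sym q)) (loopless f)
  ... | yes p | no _ = begin
    z *ᶜ incidence j f                       ≡⟨ ≡.cong (z *ᶜ_) (if-yes (j ≟ᶠ src f) (≡.sym p)) ⟩
    z *ᶜ s f                                 ≈⟨ K.+-identityʳ (z *ᶜ s f) ⟨
    z *ᶜ s f +ᶜ 0ᶜ                           ≈⟨ K.+-cong (K.*-identityˡ (z *ᶜ s f)) (K.zeroˡ (z *ᶜ s* f)) ⟨
    1ᶜ *ᶜ (z *ᶜ s f) +ᶜ 0ᶜ *ᶜ (z *ᶜ s* f)    ∎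
  ... | no ¬p | yes q = begin
    z *ᶜ incidence j f                       ≡⟨ ≡.cong (z *ᶜ_) (≡.trans (if-no (j ≟ᶠ src f) (¬p ∘ ≡.sym))
                                                                       (if-yes (j ≟ᶠ tgt f) (≡.sym q))) ⟩
    z *ᶜ s* f                                ≈⟨ K.+-identityˡ (z *ᶜ s* f) ⟨
    0ᶜ +ᶜ z *ᶜ s* f                          ≈⟨ K.+-cong (K.zeroˡ (z *ᶜ s f)) (K.*-identityˡ (z *ᶜ s* f)) ⟨
    0ᶜ *ᶜ (z *ᶜ s f) +ᶜ 1ᶜ *ᶜ (z *ᶜ s* f)    ∎
  ... | no ¬p | no ¬q = begin
    z *ᶜ incidence j f                       ≡⟨ ≡.cong (z *ᶜ_) (≡.trans (if-no (j ≟ᶠ src f) (¬p ∘ ≡.sym))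
                                                                       (if-no (j ≟ᶠ tgt f) (¬q ∘ ≡.sym))) ⟩
    z *ᶜ 0ᶜ                                  ≈⟨ K.zeroʳ z ⟩
    0ᶜ                                       ≈⟨ K.+-identityˡ 0ᶜ ⟨
    0ᶜ +ᶜ 0ᶜ                                 ≈⟨ K.+-cong (K.zeroˡ (z *ᶜ s f)) (K.zeroˡ (z *ᶜ s* f)) ⟨
    0ᶜ *ᶜ (z *ᶜ s f) +ᶜ 0ᶜ *ᶜ (z *ᶜ s* f)    ∎

  product-entry : ∀ {l} (X : Matrix l n) i f →
    (X *ᴹ incidence) i f ≈ᶜ X i (src f) *ᶜ s f +ᶜ X i (tgt f) *ᶜ s* f
  product-entry X i f = begin
    sum (λ j → X i j *ᶜ incidence j f)
      ≈⟨ sum-cong (λ j → incidence-split f j (X i j)) ⟩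
    sum (λ j → at-src j +ᶜ at-tgt j)
      ≈⟨ CommutativeMonoidSum.∑-distrib-+ K.+-commutativeMonoid at-src at-tgt ⟩
    sum at-src +ᶜ sum at-tgt
      ≈⟨ K.+-cong (sum-identityˡ (src f) (λ j → X i j *ᶜ s f)) (sum-identityˡ (tgt f) (λ j → X i j *ᶜ s* f)) ⟩
    X i (src f) *ᶜ s f +ᶜ X i (tgt f) *ᶜ s* f ∎
    where
    at-src at-tgt : Fin n → ℂ
    at-src j = identity (src f) j *ᶜ (X i j *ᶜ s f)
    at-tgt j = identity (tgt f) j *ᶜ (X i j *ᶜ s* f)

  cycle-walk : ∀ {e} → e ∈ᶜ C → Star (AdjWithout e) (src e) (tgt e)
  cycle-walk {e} e∈C = lemma (Parity.openCycle G C e∈C)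
    where
    lemma : ∀ {A : (x y : Fin n) → Star (AdjWithout e) y x → Set} →
            (∃ λ x → ∃ λ y → Joins e x y × ∃ (A x y)) → Star (AdjWithout e) (src e) (tgt e)
    lemma (_ , _ , inj₁ (≡.refl , ≡.refl) , q , _) = reverse q
    lemma (_ , _ , inj₂ (≡.refl , ≡.refl) , q , _) = q

  -- G - e stays connected: the rest of C bypasses e.
  walk-to-source : ∀ {e} → e ∈ᶜ C → ∀ j → Star (AdjWithout e) j (src e)
  walk-to-source {e} e∈C j = detour (joins-self e) (cycle-walk e∈C) (connected j (src e))

  -- The entries of F and their change along an edge.

  phase : Fin n → Fin n → Fin n → ℂ
  phase e x y = unit (wtγ e x y)

  phase-step : ∀ {e x y z} → Acyclic e z → AdjWithout e x y → Star (AdjWithout e) z x →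
               phase e z y ≈ᶜ phase e z x *ᶜ unitOf x y
  phase-step {e} {x} {y} {z} acyclic r q = begin
    phase e z y                              ≈⟨ unit-wtγ acyclic (q ◅◅ (r ◅ ε)) ⟩
    Phase.gain (q ◅◅ (r ◅ ε))                ≈⟨ Phase.gain-◅◅ q (r ◅ ε) ⟩
    Phase.gain q *ᶜ (unitOf x y *ᶜ 1ᶜ)       ≈⟨ K.*-cong (K.sym (unit-wtγ acyclic q)) (K.*-identityʳ (unitOf x y)) ⟩
    phase e z x *ᶜ unitOf x y                ∎

  denominator : Fin n → ℂ
  denominator e = s* e *ᶜ (unit (w e) -ᶜ phase e (src e) (tgt e))

  cycleTerm : Fin n → Fin n → ℂ
  cycleTerm e j = sign e j (src e) *ᶜ (phase e (src e) j /ᶜ denominator e)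

  treeTerm : Fin n → Fin n → ℂ → Fin n → ℂ
  treeTerm e z t j = sign e j z *ᶜ t *ᶜ phase⁻¹ {e} j z

  opaque
    entry : Fin n → Fin n → ℂ
    entry = F C

    entry-def : ∀ e j → entry e j ≡ F C e j
    entry-def e j = ≡.refl

  module _ {e : Fin n} where

    F-cycle : e ∈ᶜ C → ∀ j → entry e j ≡ cycleTerm e j
    -- The two sides agree definitionally, but a single refl would compare every factor of
    -- each complex product twice, hence exponentially often in the nesting depth.
    F-cycle e∈C j = ≡.trans (entry-def e j) (≡.trans (if-yes (e ∈ᶜ? C) e∈C)
      (≡.cong₂ _*ᶜ_ ≡.refl (≡.cong₂ _/ᶜ_ ≡.refl (≡.cong₂ _*ᶜ_ ≡.refl (≡.cong₂ _-ᶜ_ ≡.refl ≡.refl)))))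

    module _ (e∉C : ¬ e ∈ᶜ C) {j : Fin n} where

      F-part : InUnicyclicPart C e j → entry e j ≡ 0ᶜ
      F-part j∈part = ≡.trans (entry-def e j) (≡.trans (if-no (e ∈ᶜ? C) e∉C) (if-yes (inUnicyclicPart? C e j) j∈part))

      F-tree-src : ¬ InUnicyclicPart C e j → InTreeAt C e (src e) j →
                   entry e j ≡ treeTerm e (src e) (1ᶜ /ᶜ s e) j
      F-tree-src j∉part j∈T = ≡.trans (entry-def e j) (≡.trans (if-no (e ∈ᶜ? C) e∉C) (≡.trans
        (if-no (inUnicyclicPart? C e j) j∉part) (≡.trans
        (if-yes (inTreeAt? C e (src e) j) j∈T)
        (≡.cong₂ _*ᶜ_ (≡.cong₂ _*ᶜ_ ≡.refl ≡.refl) (≡.cong₂ _/ᶜ_ ≡.refl ≡.refl)))))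

      F-tree-tgt : ¬ InUnicyclicPart C e j → ¬ InTreeAt C e (src e) j → InTreeAt C e (tgt e) j →
                   entry e j ≡ treeTerm e (tgt e) (1ᶜ /ᶜ s* e) j
      F-tree-tgt j∉part j∉S j∈T = ≡.trans (entry-def e j) (≡.trans (if-no (e ∈ᶜ? C) e∉C) (≡.trans
        (if-no (inUnicyclicPart? C e j) j∉part) (≡.trans
        (if-no (inTreeAt? C e (src e) j) j∉S) (≡.trans
        (if-yes (inTreeAt? C e (tgt e) j) j∈T)
        (≡.cong₂ _*ᶜ_ (≡.cong₂ _*ᶜ_ ≡.refl ≡.refl) (≡.cong₂ _/ᶜ_ ≡.refl ≡.refl))))))

      F-nowhere : ¬ InUnicyclicPart C e j → ¬ InTreeAt C e (src e) j → ¬ InTreeAt C e (tgt e) j →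
                  entry e j ≡ 0ᶜ
      F-nowhere j∉part j∉S j∉T = ≡.trans (entry-def e j) (≡.trans (if-no (e ∈ᶜ? C) e∉C) (≡.trans
        (if-no (inUnicyclicPart? C e j) j∉part) (≡.trans
        (if-no (inTreeAt? C e (src e) j) j∉S) (if-no (inTreeAt? C e (tgt e) j) j∉T))))

    cycleTerm-step : e ∈ᶜ C → ∀ {x y} → AdjWithout e x y →
                     cycleTerm e y ≈ᶜ -1ᶜ *ᶜ (cycleTerm e x *ᶜ unitOf x y)
    cycleTerm-step e∈C {x = x} {y} r = K.trans
      (K.*-cong (sign-step (acyclic-onCycle U e∈C x) r p)
                (K.*-congʳ {inv (denominator e)}
                  (phase-step (acyclic-onCycle U e∈C (src e)) r (reverse p))))
      (regroup -1ᶜ (sign e x (src e)) (phase e (src e) x) (unitOf x y) (inv (denominator e)))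
      where
      p : Star (AdjWithout e) x (src e)
      p = walk-to-source e∈C x

      regroup : ∀ m σ ρ ω i → m *ᶜ σ *ᶜ (ρ *ᶜ ω *ᶜ i) ≈ᶜ m *ᶜ (σ *ᶜ (ρ *ᶜ i) *ᶜ ω)
      regroup = T.solve 5 (λ m σ ρ ω i →
        m T.:* σ T.:* (ρ T.:* ω T.:* i) T.:= m T.:* (σ T.:* (ρ T.:* i) T.:* ω)) K.refl

    treeTerm-step : ∀ {x y z} t → Acyclic e x → AdjWithout e x y → Star (AdjWithout e) x z →
                    treeTerm e z t y ≈ᶜ -1ᶜ *ᶜ (treeTerm e z t x *ᶜ unitOf x y)
    treeTerm-step {x} {y} {z} t acyclic r p = K.trans
      (K.*-cong (K.*-congʳ {t} (sign-step acyclic r p)) (phase⁻¹-step acyclic r p))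
      (regroup -1ᶜ (sign e x z) t (phase⁻¹ x z) (unitOf x y))
      where
      regroup : ∀ m σ t ρ ω → m *ᶜ σ *ᶜ t *ᶜ (ρ *ᶜ ω) ≈ᶜ m *ᶜ (σ *ᶜ t *ᶜ ρ *ᶜ ω)
      regroup = T.solve 5 (λ m σ t ρ ω →
        m T.:* σ T.:* t T.:* (ρ T.:* ω) T.:= m T.:* (σ T.:* t T.:* ρ T.:* ω)) K.refl

    treeTerm-root : ∀ {z} t → Acyclic e z → treeTerm e z t z ≈ᶜ t
    treeTerm-root {z} t acyclic = begin
      sign e z z *ᶜ t *ᶜ phase⁻¹ z z     ≈⟨ K.*-cong (K.*-congʳ {t} (sign-walk acyclic ε)) phase⁻¹≈1 ⟩
      1ᶜ *ᶜ t *ᶜ 1ᶜ                      ≈⟨ K.*-identityʳ (1ᶜ *ᶜ t) ⟩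
      1ᶜ *ᶜ t                            ≈⟨ K.*-identityˡ t ⟩
      t                                  ∎
      where
      phase⁻¹≈1 : phase⁻¹ z z ≈ᶜ 1ᶜ
      phase⁻¹≈1 = K.trans (K.sym (K.*-identityʳ (phase⁻¹ z z))) (phase⁻¹-walk acyclic ε)

    -- The ends of an edge other than e lie in the same component of G - e. So the same case of `F`
    -- applies to x and y, and each case satisfies the recursion by itself.
    F-step : ∀ {x y} → AdjWithout e x y → entry e y ≈ᶜ -1ᶜ *ᶜ (entry e x *ᶜ unitOf x y)
    F-step {x} {y} r = cases (e ∈ᶜ? C) (inUnicyclicPart? C e x)
                             (inTreeAt? C e (src e) x) (inTreeAt? C e (tgt e) x)
      where
      r⁻¹ : AdjWithout e y x
      r⁻¹ = adjWithout-sym r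

      Step : ℂ → ℂ → Set
      Step fx fy = fy ≈ᶜ -1ᶜ *ᶜ (fx *ᶜ unitOf x y)

      transport : ∀ {fx fy} → entry e x ≡ fx → entry e y ≡ fy → Step fx fy → Step (entry e x) (entry e y)
      transport p q = ≡.subst₂ Step (≡.sym p) (≡.sym q)

      zero-step : Step 0ᶜ 0ᶜ
      zero-step = K.sym (K.trans (K.*-congˡ { -1ᶜ } (K.zeroˡ (unitOf x y))) (K.zeroʳ -1ᶜ))

      tree-at : ∀ {z} → InTreeAt C e z x → InTreeAt C e z y
      tree-at (z∉part , p) = z∉part , (r⁻¹ ◅ p)

      tree-at⁻¹ : ∀ {z} → ¬ InTreeAt C e z x → ¬ InTreeAt C e z y
      tree-at⁻¹ x∉T (z∉part , p) = x∉T (z∉part , (r ◅ p))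

      cases : Dec (e ∈ᶜ C) → Dec (InUnicyclicPart C e x) →
              Dec (InTreeAt C e (src e) x) → Dec (InTreeAt C e (tgt e) x) →
              Step (entry e x) (entry e y)
      cases (yes e∈C) _ _ _ = transport (F-cycle e∈C x) (F-cycle e∈C y) (cycleTerm-step e∈C {x = x} {y} r)
      cases (no e∉C) (yes p) _ _ = transport (F-part e∉C {x} p) (F-part e∉C {y} (r⁻¹ ◅ p)) zero-step
      cases (no e∉C) (no x∉P) S? T? = outside S? T?
        where
        y∉P : ¬ InUnicyclicPart C e y
        y∉P p = x∉P (r ◅ p)

        acyclic : Acyclic e x
        acyclic = acyclic-tree U e∉C x∉P

        outside : Dec (InTreeAt C e (src e) x) → Dec (InTreeAt C e (tgt e) x) →
                  Step (entry e x) (entry e y)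
        outside (yes x∈S) _ = transport (F-tree-src e∉C {x} x∉P x∈S) (F-tree-src e∉C {y} y∉P (tree-at x∈S))
          (treeTerm-step {x = x} {y} {src e} (1ᶜ /ᶜ s e) acyclic r (proj₂ x∈S))
        outside (no x∉S) (yes x∈T) = transport (F-tree-tgt e∉C {x} x∉P x∉S x∈T)
          (F-tree-tgt e∉C {y} y∉P (tree-at⁻¹ x∉S) (tree-at x∈T))
          (treeTerm-step {x = x} {y} {tgt e} (1ᶜ /ᶜ s* e) acyclic r (proj₂ x∈T))
        outside (no x∉S) (no x∉T) = transport (F-nowhere e∉C {x} x∉P x∉S x∉T)
          (F-nowhere e∉C {y} y∉P (tree-at⁻¹ x∉S) (tree-at⁻¹ x∉T)) zero-step

  -- The entries of F N.

  unit-*-s* : ∀ e → unit (w e) *ᶜ s* e ≈ᶜ s e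
  unit-*-s* e = unit-*-√ᶜ-conj (w≉0 e) (w∉ℝ⁻ e)

  unitOf-*-s* : ∀ e → unitOf (src e) (tgt e) *ᶜ s* e ≈ᶜ s e
  unitOf-*-s* e = ≡.subst (λ z → z *ᶜ s* e ≈ᶜ s e) (≡.sym (unitOf-edge e)) (unit-*-s* e)

  -1*≈- : ∀ x → -1ᶜ *ᶜ x ≈ᶜ -ᶜ x
  -1*≈- x = K.trans (K.sym (RingProperties.-‿distribˡ-* K.ring 1ᶜ x)) (K.-‿cong (K.*-identityˡ x))

  cancelled-terms : ∀ {x y ω t t*} → y ≈ᶜ -1ᶜ *ᶜ (x *ᶜ ω) → ω *ᶜ t* ≈ᶜ t → x *ᶜ t +ᶜ y *ᶜ t* ≈ᶜ 0ᶜ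
  cancelled-terms {x} {y} {ω} {t} {t*} y≈ ωt*≈t = begin
    x *ᶜ t +ᶜ y *ᶜ t*                       ≈⟨ K.+-congˡ {x *ᶜ t} (K.*-congʳ {t*} y≈) ⟩
    x *ᶜ t +ᶜ -1ᶜ *ᶜ (x *ᶜ ω) *ᶜ t*         ≈⟨ K.+-congˡ {x *ᶜ t} (regroup -1ᶜ x ω t*) ⟩
    x *ᶜ t +ᶜ -1ᶜ *ᶜ (x *ᶜ (ω *ᶜ t*))       ≈⟨ K.+-congˡ {x *ᶜ t} (K.*-congˡ { -1ᶜ } (K.*-congˡ {x} ωt*≈t)) ⟩
    x *ᶜ t +ᶜ -1ᶜ *ᶜ (x *ᶜ t)               ≈⟨ K.+-congˡ {x *ᶜ t} (-1*≈- (x *ᶜ t)) ⟩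
    x *ᶜ t -ᶜ x *ᶜ t                        ≈⟨ K.-‿inverseʳ (x *ᶜ t) ⟩
    0ᶜ                                      ∎
    where
    regroup : ∀ m x u t → m *ᶜ (x *ᶜ u) *ᶜ t ≈ᶜ m *ᶜ (x *ᶜ (u *ᶜ t))
    regroup = T.solve 4 (λ m x u t → m T.:* (x T.:* u) T.:* t T.:= m T.:* (x T.:* (u T.:* t))) K.refl

  FN-offDiagonal : ∀ {e f} → f ≢ e → entry e (src f) *ᶜ s f +ᶜ entry e (tgt f) *ᶜ s* f ≈ᶜ 0ᶜ
  FN-offDiagonal {e} {f} f≢e = cancelled-terms
    {entry e (src f)} {entry e (tgt f)} {unitOf (src f) (tgt f)} {s f} {s* f}
    (F-step {e} {src f} {tgt f} (f , f≢e , joins-self f))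
    (unitOf-*-s* f)

  inv-*  : ∀ {z} → ¬ z ≈ᶜ 0ᶜ → 1ᶜ /ᶜ z *ᶜ z ≈ᶜ 1ᶜ
  inv-* {z} z≉0 = begin
    1ᶜ *ᶜ inv z *ᶜ z   ≈⟨ K.*-congʳ {z} (K.*-identityˡ (inv z)) ⟩
    inv z *ᶜ z         ≈⟨ K.*-comm (inv z) z ⟩
    z *ᶜ inv z         ≈⟨ *-inv z≉0 ⟩
    1ᶜ                 ∎

  inverse-right : ∀ {t r z} → ¬ z ≈ᶜ 0ᶜ → t ≈ᶜ 1ᶜ /ᶜ z → 0ᶜ *ᶜ r +ᶜ t *ᶜ z ≈ᶜ 1ᶜ
  inverse-right {t} {r} {z} z≉0 t≈ = begin
    0ᶜ *ᶜ r +ᶜ t *ᶜ z     ≈⟨ K.+-cong (K.zeroˡ r) (K.*-congʳ {z} t≈) ⟩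
    0ᶜ +ᶜ 1ᶜ /ᶜ z *ᶜ z    ≈⟨ K.+-identityˡ (1ᶜ /ᶜ z *ᶜ z) ⟩
    1ᶜ /ᶜ z *ᶜ z          ≈⟨ inv-* z≉0 ⟩
    1ᶜ                    ∎

  s-nonzero : ∀ e → ¬ s e ≈ᶜ 0ᶜ
  s-nonzero e = √ᶜ-nonzero (w≉0 e)

  s*-nonzero : ∀ e → ¬ s* e ≈ᶜ 0ᶜ
  s*-nonzero e = √ᶜ-nonzero (conj-nonzero (w≉0 e))

  -- The end of e in the unicyclic part contributes 0. The other end is the root of the tree, where
  -- sign and phase are trivial and the entry is the reciprocal of the root of the weight that it
  -- meets.
  FN-diagonal-tree : ∀ {e} → ¬ e ∈ᶜ C → entry e (src e) *ᶜ s e +ᶜ entry e (tgt e) *ᶜ s* e ≈ᶜ 1ᶜ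
  FN-diagonal-tree {e} e∉C = cases (part-meets-edge U e)
    where
    Diagonal : ℂ → ℂ → Set
    Diagonal fu fv = fu *ᶜ s e +ᶜ fv *ᶜ s* e ≈ᶜ 1ᶜ

    transport : ∀ {fu fv} → entry e (src e) ≡ fu → entry e (tgt e) ≡ fv →
                Diagonal fu fv → Diagonal (entry e (src e)) (entry e (tgt e))
    transport p q = ≡.subst₂ Diagonal (≡.sym p) (≡.sym q)

    cases : InUnicyclicPart C e (src e) ⊎ InUnicyclicPart C e (tgt e) →
            Diagonal (entry e (src e)) (entry e (tgt e))
    cases (inj₁ u∈P) = transport (F-part e∉C {src e} u∈P)
      (F-tree-tgt e∉C {tgt e} v∉P (λ (u∉P , _) → u∉P u∈P) (v∉P , ε))
      (inverse-right {treeTerm e (tgt e) (1ᶜ /ᶜ s* e) (tgt e)} {s e} (s*-nonzero e)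
        (treeTerm-root {z = tgt e} (1ᶜ /ᶜ s* e) (acyclic-tree U e∉C v∉P)))
      where
      v∉P : ¬ InUnicyclicPart C e (tgt e)
      v∉P v∈P = ends-separated U e∉C (u∈P , v∈P)
    cases (inj₂ v∈P) = transport (F-tree-src e∉C {src e} u∉P (u∉P , ε)) (F-part e∉C {tgt e} v∈P)
      (K.trans (K.+-comm (treeTerm e (src e) (1ᶜ /ᶜ s e) (src e) *ᶜ s e) (0ᶜ *ᶜ s* e))
        (inverse-right {treeTerm e (src e) (1ᶜ /ᶜ s e) (src e)} {s* e} (s-nonzero e)
          (treeTerm-root {z = src e} (1ᶜ /ᶜ s e) (acyclic-tree U e∉C u∉P))))
      where
      u∉P : ¬ InUnicyclicPart C e (src e)
      u∉P u∈P = ends-separated U e∉C (u∈P , v∈P)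

  module _ (even : EvenCycle C) (wtC∉ℝ⁺ : ¬ PositiveReal (wt (closedWalk C))) where

    cycle-parity : Parity.gain (closedWalk C) ≈ᶜ 1ᶜ
    cycle-parity = lemma even
      where
      lemma : EvenCycle C → Parity.gain (closedWalk C) ≈ᶜ 1ᶜ
      lemma (divides k eq) = K.trans
        (K.reflexive (≡.trans (parity-length (closedWalk C)) (≡.cong (-1ᶜ ^ᶜ_) eq))) (parity-even k)

    module _ {e : Fin n} (e∈C : e ∈ᶜ C) where

      private
        γ : Star (AdjWithout e) (src e) (tgt e)
        γ = cycle-walk e∈C

        acyclic : ∀ i → Acyclic e i
        acyclic = acyclic-onCycle U e∈C

        ω Γ I : ℂ
        ω = unit (w e)
        Γ = phase e (src e) (tgt e)
        I = inv (denominator e)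

      -- An even cycle without one edge has odd length.
      sign-reversed : sign e (tgt e) (src e) ≈ᶜ -1ᶜ
      sign-reversed = begin
        sign e (tgt e) (src e)               ≈⟨ sign-walk (acyclic (tgt e)) (reverse γ) ⟩
        Parity.gain (reverse γ)              ≈⟨ K.*-identityˡ (Parity.gain (reverse γ)) ⟨
        1ᶜ *ᶜ Parity.gain (reverse γ)        ≈⟨ K.*-congʳ {Parity.gain (reverse γ)}
                                                  (Parity.cycle-gain-trivial⇒ U e∈C γ cycle-parity) ⟨
        -1ᶜ *ᶜ Parity.gain γ *ᶜ Parity.gain (reverse γ)
          ≈⟨ K.*-assoc -1ᶜ (Parity.gain γ) (Parity.gain (reverse γ)) ⟩
        -1ᶜ *ᶜ (Parity.gain γ *ᶜ Parity.gain (reverse γ))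
          ≈⟨ K.*-congˡ { -1ᶜ } (Parity.gain-◅◅ γ (reverse γ)) ⟨
        -1ᶜ *ᶜ Parity.gain (γ ◅◅ reverse γ)
          ≈⟨ K.*-congˡ { -1ᶜ } (Parity.gain-closed (γ ◅◅ reverse γ) (acyclic (src e))) ⟩
        -1ᶜ *ᶜ 1ᶜ                            ≈⟨ K.*-identityʳ -1ᶜ ⟩
        -1ᶜ                                  ∎

      -- If ω = Γ, then e passed backwards followed by `γ` has trivial unit weight. This walk goes
      -- once around C, so wt(C) would be a positive real.
      denominator-nonzero : ¬ denominator e ≈ᶜ 0ᶜ
      denominator-nonzero = *-nonzero (s*-nonzero e) λ ω-Γ≈0 →
        wtC∉ℝ⁺ (unit≈1⇒positive (wt-nonzero (λ r → r) (closedWalk C)) (begin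
          unit (wt (closedWalk C))       ≈⟨ unit-wt (λ r → r) (closedWalk C) ⟩
          Phase.gain (closedWalk C)      ≈⟨ Phase.cycle-gain-trivial⇐ U e∈C γ (trivial ω-Γ≈0) ⟩
          1ᶜ                             ∎))
        where
        trivial : ω -ᶜ Γ ≈ᶜ 0ᶜ → unitOf (tgt e) (src e) *ᶜ Phase.gain γ ≈ᶜ 1ᶜ
        trivial ω-Γ≈0 = begin
          unitOf (tgt e) (src e) *ᶜ Phase.gain γ    ≈⟨ K.*-congˡ {unitOf (tgt e) (src e)}
                                                        (unit-wtγ (acyclic (src e)) γ) ⟨
          unitOf (tgt e) (src e) *ᶜ Γ               ≈⟨ K.*-congˡ {unitOf (tgt e) (src e)} ω≈Γ ⟨
          unitOf (tgt e) (src e) *ᶜ ω               ≡⟨ ≡.cong (unitOf (tgt e) (src e) *ᶜ_) (unitOf-edge e) ⟨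
          unitOf (tgt e) (src e) *ᶜ unitOf (src e) (tgt e)
            ≈⟨ unitOf-inverse (e , swap (joins-self e)) ⟩
          1ᶜ                                        ∎
          where
          ω≈Γ : ω ≈ᶜ Γ
          ω≈Γ = begin
            ω                   ≈⟨ K.+-identityʳ ω ⟨
            ω +ᶜ 0ᶜ             ≈⟨ K.+-congˡ {ω} (K.-‿inverseˡ Γ) ⟨
            ω +ᶜ (-ᶜ Γ +ᶜ Γ)    ≈⟨ K.+-assoc ω (-ᶜ Γ) Γ ⟨
            ω -ᶜ Γ +ᶜ Γ         ≈⟨ K.+-congʳ {Γ} ω-Γ≈0 ⟩
            0ᶜ +ᶜ Γ             ≈⟨ K.+-identityˡ Γ ⟩
            Γ                   ∎

      cycleTerm-src : cycleTerm e (src e) ≈ᶜ I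
      cycleTerm-src = begin
        sign e (src e) (src e) *ᶜ (phase e (src e) (src e) *ᶜ I)
          ≈⟨ K.*-cong (sign-walk (acyclic (src e)) ε) (K.*-congʳ {I} (unit-wtγ (acyclic (src e)) ε)) ⟩
        1ᶜ *ᶜ (1ᶜ *ᶜ I)   ≈⟨ K.*-identityˡ (1ᶜ *ᶜ I) ⟩
        1ᶜ *ᶜ I           ≈⟨ K.*-identityˡ I ⟩
        I                 ∎

      -- This sum is the origin of the denominator in `F`: the entries at source and target are `I`
      -- and -Γ `I`, so with s = ω s* the sum is s* (ω - Γ) `I`.
      FN-diagonal-cycle : entry e (src e) *ᶜ s e +ᶜ entry e (tgt e) *ᶜ s* e ≈ᶜ 1ᶜ
      FN-diagonal-cycle = begin
        entry e (src e) *ᶜ s e +ᶜ entry e (tgt e) *ᶜ s* e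
          ≡⟨ ≡.cong₂ (λ x y → x *ᶜ s e +ᶜ y *ᶜ s* e) (F-cycle e∈C (src e)) (F-cycle e∈C (tgt e)) ⟩
        cycleTerm e (src e) *ᶜ s e +ᶜ cycleTerm e (tgt e) *ᶜ s* e
          ≈⟨ K.+-cong (K.*-cong cycleTerm-src (K.sym (unit-*-s* e)))
                      (K.*-congʳ {s* e} (K.*-congʳ {Γ *ᶜ I} sign-reversed)) ⟩
        I *ᶜ (ω *ᶜ s* e) +ᶜ -1ᶜ *ᶜ (Γ *ᶜ I) *ᶜ s* e
          ≈⟨ regroup I ω (s* e) -1ᶜ Γ ⟩
        s* e *ᶜ (ω +ᶜ -1ᶜ *ᶜ Γ) *ᶜ I
          ≈⟨ K.*-congʳ {I} (K.*-congˡ {s* e} (K.+-congˡ {ω} (K.trans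
               (K.sym (RingProperties.-‿distribˡ-* K.ring 1ᶜ Γ)) (K.-‿cong (K.*-identityˡ Γ))))) ⟩
        denominator e *ᶜ I
          ≈⟨ *-inv denominator-nonzero ⟩
        1ᶜ ∎
        where
        regroup : ∀ i ω t m g → i *ᶜ (ω *ᶜ t) +ᶜ m *ᶜ (g *ᶜ i) *ᶜ t ≈ᶜ t *ᶜ (ω +ᶜ m *ᶜ g) *ᶜ i
        regroup = T.solve 5 (λ i ω t m g →
          i T.:* (ω T.:* t) T.:+ m T.:* (g T.:* i) T.:* t T.:= t T.:* (ω T.:+ m T.:* g) T.:* i) K.refl

    entryN≈I : entry *ᴹ incidence ≈ᴹ identity
    entryN≈I e f = cases (e ≟ᶠ f)
      where
      cases : Dec (e ≡ f) → (entry *ᴹ incidence) e f ≈ᶜ identity e f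
      cases (no e≢f) = begin
        (entry *ᴹ incidence) e f                          ≈⟨ product-entry entry e f ⟩
        entry e (src f) *ᶜ s f +ᶜ entry e (tgt f) *ᶜ s* f ≈⟨ FN-offDiagonal (e≢f ∘ ≡.sym) ⟩
        0ᶜ                                                ≡⟨ if-no (e ≟ᶠ f) e≢f ⟨
        identity e f                                      ∎
      cases (yes ≡.refl) = begin
        (entry *ᴹ incidence) e e                          ≈⟨ product-entry entry e e ⟩
        entry e (src e) *ᶜ s e +ᶜ entry e (tgt e) *ᶜ s* e ≈⟨ diagonal (e ∈ᶜ? C) ⟩
        1ᶜ                                                ≡⟨ if-yes (e ≟ᶠ e) ≡.refl ⟨
        identity e e                                      ∎
        where
        diagonal : Dec (e ∈ᶜ C) → entry e (src e) *ᶜ s e +ᶜ entry e (tgt e) *ᶜ s* e ≈ᶜ 1ᶜ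
        diagonal (yes e∈C) = FN-diagonal-cycle e∈C
        diagonal (no e∉C)  = FN-diagonal-tree e∉C

    opaque
      unfolding entry

      FN≈I : F C *ᴹ incidence ≈ᴹ identity
      FN≈I = entryN≈I

-- From a two-sided inverse to the Moore-Penrose inverse.

module _ (ℝ : CompleteOrderedField) where

  open Complex ℝ
  open ComplexProperties ℝ
  open LinearAlgebra ℂ-field
  private
    module K = CommutativeRing ℂ-commutativeRing
  open SetoidReasoning K.setoid

  -- Both products are the identity matrix, which is real and symmetric, hence Hermitian.
  inverse⇒MoorePenrose : ∀ {n} {A X : Matrix n n} →
    A *ᴹ X ≈ᴹ identity → X *ᴹ A ≈ᴹ identity → IsMoorePenroseInverse A X
  inverse⇒MoorePenrose {n} {A} {X} AX≈I XA≈I = record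
    { AXA≈A        = identityˡ AX≈I A
    ; XAX≈X        = identityˡ XA≈I X
    ; AX-hermitian = hermitian AX≈I
    ; XA-hermitian = hermitian XA≈I
    }
    where
    identityˡ : ∀ {B : Matrix n n} → B ≈ᴹ identity → (D : Matrix n n) → B *ᴹ D ≈ᴹ D
    identityˡ B≈I D i j = K.trans (sum-cong {n} λ k → K.*-congʳ {D k j} (B≈I i k))
      (sum-identityˡ i (λ k → D k j))

    conj-identity : ∀ (i j : Fin n) → conj (identity i j) ≈ᶜ identity i j
    conj-identity i j with does (i ≟ᶠ j)
    ... | true  = CompleteOrderedField.refl ℝ , -0≈0
      where -0≈0 = RingProperties.-0#≈0# (CompleteOrderedField.ring ℝ)
    ... | false = CompleteOrderedField.refl ℝ , -0≈0
      where -0≈0 = RingProperties.-0#≈0# (CompleteOrderedField.ring ℝ)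

    hermitian : ∀ {B : Matrix n n} → B ≈ᴹ identity → B ᴴ ≈ᴹ B
    hermitian {B} B≈I i j = begin
      conj (B j i)            ≈⟨ conj-cong (B≈I j i) ⟩
      conj (identity j i)     ≈⟨ conj-identity j i ⟩
      identity j i            ≡⟨ identity-sym j i ⟩
      identity i j            ≈⟨ B≈I i j ⟨
      B i j                   ∎

theorem3p4 : (ℝ : CompleteOrderedField) (let open Complex ℝ)
    (n : ℕ) → 2 ≤ n →
    (G : OrientedGraph n n) (let open OrientedGraph G)
    (U : Unicyclic) (let C = Unicyclic.cycle U) → EvenCycle C →
    (w : Fin n → ℂ) (let open Weighted ℝ G w) →
    (∀ e → ¬ (w e ≈ᶜ 0ᶜ)) →
    (∀ e → ¬ NegativeReal (w e)) →
    ¬ PositiveReal (wt (closedWalk C)) →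
    IsMoorePenroseInverse incidence (F C)
theorem3p4 ℝ n _ G U even w w≉0 w∉ℝ⁻ wtC∉ℝ⁺ = inverse⇒MoorePenrose ℝ
  (LinearAlgebra.leftInverse⇒rightInverse (ComplexProperties.ℂ-field ℝ) FN≈I) FN≈I
  where
  FN≈I = Inverse.FN≈I ℝ G U w w≉0 w∉ℝ⁻ even wtC∉ℝ⁺
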